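{- Let $\mathcal{A}=\lambda/\mu$ be a skew diagram. Then $hl(\mathcal{A})=\pi_{nw}(\mathcal{A})$.
   Context: Partitions are identified with Young diagrams in matrix coordinates. For $\mu\subseteq\lambda$ the skew diagram $\lambda/\mu$ is the set of boxes of $\lambda$ not in $\mu$. The skew character is $[\lambda/\mu]=\sum_\nu c(\lambda;\mu,\nu)[\nu]$ with $c$ the Littlewood–Richardson coefficients and $[\nu]$ irreducible characters of the symmetric group; $[\nu]$ appears in $[\mathcal{A}]$ iff its coefficient is nonzero. Northwest ribbons: $nw_1(\mathcal{A})$ is the set of boxes $(i,j)\in\mathcal{A}$ with $(i-1,j-1)\notin\mathcal{A}$ (for connected $\mathcal{A}$, the ribbon along the northwest border from the lowest box of the leftmost column to the rightmost box of the top row; for disconnected $\mathcal{A}$, the union of the $nw_1$ of its connected components), and $nw_{k+1}(\mathcal{A})$ is $nw_1$ of the diagram obtained from $\mathcal{A}$ by removing $nw_1(\mathcal{A}),\dots,nw_k(\mathcal{A})$. $\pi_{nw}(\mathcal{A})=(|nw_1(\mathcal{A})|,|nw_2(\mathcal{A})|,\dots)$. For a partition $\nu$, $hl_i(\nu)$ is the hook length of box $(i,i)$ (zero if absent) and $hl(\nu)=(hl_1(\nu),hl_2(\nu),\dots)$; $hl(\mathcal{A})$ is the lexicographically largest $hl(\nu)$ among all $\nu$ with $[\nu]$ appearing in $[\mathcal{A}]$. -}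

module Defs where

open import Data.Nat using (ℕ; zero; suc; _+_; _∸_; _≤_; _<_; _≡ᵇ_; _≤ᵇ_; _<ᵇ_)
open import Data.Bool using (Bool; true; false; _∧_; _∨_; not; if_then_else_)
open import Data.List using (List; []; _∷_; length; map; concatMap; applyUpTo; filterᵇ; reverse; zip; inits)
open import Data.Product using (_×_; _,_; Σ; ∃)
open import Data.Sum using (_⊎_)
open import Data.Unit using (⊤)
open import Relation.Nullary using (¬_)
open import Relation.Binary.PropositionalEquality using (_≡_)

IsPartition : List ℕ → Set
IsPartition []           = ⊤
IsPartition (x ∷ [])     = 1 ≤ x
IsPartition (x ∷ y ∷ xs) = (y ≤ x) × IsPartition (y ∷ xs)

-- Length of row i (rows indexed from 1; 0 for nonexistent rows).
rowLen : List ℕ → ℕ → ℕ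
rowLen []       _             = 0
rowLen (x ∷ xs) zero          = 0
rowLen (x ∷ xs) (suc zero)    = x
rowLen (x ∷ xs) (suc (suc i)) = rowLen xs (suc i)

_⊆ₚ_ : List ℕ → List ℕ → Set
mu ⊆ₚ la = ∀ i → rowLen mu i ≤ rowLen la i

-- Boxes in matrix coordinates (row i, column j), both starting at 1.

Box : Set
Box = ℕ × ℕ

-- Boxes of the skew diagram λ/μ, listed in reverse reading order:
-- rows top to bottom, each row from right to left.
skewBoxes : List ℕ → List ℕ → List Box
skewBoxes la mu =
  concatMap (λ i → reverse (applyUpTo (λ k → (i , suc (rowLen mu i + k)))
                                       (rowLen la i ∸ rowLen mu i)))
            (applyUpTo suc (length la))

boxEq : Box → Box → Bool
boxEq (i , j) (i' , j') = (i ≡ᵇ i') ∧ (j ≡ᵇ j')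

memB : Box → List Box → Bool
memB b []       = false
memB b (c ∷ cs) = boxEq b c ∨ memB b cs

-- nw₁(A) = { (i,j) ∈ A | (i-1,j-1) ∉ A }
-- (boxes have coordinates ≥ 1, so truncated subtraction is harmless)
nw1 : List Box → List Box
nw1 A = filterᵇ (λ { (i , j) → not (memB (i ∸ 1 , j ∸ 1) A) }) A

dropNw1 : List Box → List Box
dropNw1 A = filterᵇ (λ { (i , j) → memB (i ∸ 1 , j ∸ 1) A }) A

iterNw : ℕ → List Box → List Box
iterNw zero    A = A
iterNw (suc k) A = dropNw1 (iterNw k A)

-- π_nw(A) as a sequence (0-indexed): πnw A k = |nw_{k+1}(A)|
πnw : List Box → ℕ → ℕ
πnw A k = length (nw1 (iterNw k A))

colLen : List ℕ → ℕ → ℕ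
colLen ν j = length (filterᵇ (λ r → j ≤ᵇ r) ν)

-- hl ν k = hl_{k+1}(ν) = hook length of box (k+1,k+1), 0 if absent
hl : List ℕ → ℕ → ℕ
hl ν k with suc k ≤ᵇ rowLen ν (suc k)
... | true  = suc ((rowLen ν (suc k) ∸ suc k) + (colLen ν (suc k) ∸ suc k))
... | false = 0

-- Littlewood–Richardson coefficients c(λ; μ, ν):
-- the number of LR tableaux of shape λ/μ and content ν, i.e. fillings
-- that are semistandard (rows weakly increasing, columns strictly
-- increasing), have content ν, and whose reverse reading word (rows top
-- to bottom, each read right to left) is a lattice word.

words : ℕ → ℕ → List (List ℕ)
words m zero    = [] ∷ []
words m (suc n) = concatMap (λ w → map (λ a → a ∷ w) (applyUpTo suc m)) (words m n)

allB : {A : Set} → (A → Bool) → List A → Bool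
allB p []       = true
allB p (x ∷ xs) = p x ∧ allB p xs

count : ℕ → List ℕ → ℕ
count a w = length (filterᵇ (λ x → x ≡ᵇ a) w)

semistandardB : List (Box × ℕ) → Bool
semistandardB T =
  allB (λ { ((i , j) , x) →
    allB (λ { ((i' , j') , y) →
        (not ((i' ≡ᵇ i) ∧ (j' ≡ᵇ suc j)) ∨ (x ≤ᵇ y))
      ∧ (not ((i' ≡ᵇ suc i) ∧ (j' ≡ᵇ j)) ∨ (x <ᵇ y)) }) T }) T

contentB : List ℕ → List ℕ → Bool
contentB ν w = allB (λ a → count a w ≡ᵇ rowLen ν a) (applyUpTo suc (length ν))

latticeB : ℕ → List ℕ → Bool
latticeB m w = allB (λ p → allB (λ a → count (suc a) p ≤ᵇ count a p) (applyUpTo suc m)) (inits w)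

-- bs: the boxes of the shape in reverse reading order; w: the entries
isLRB : List Box → List ℕ → List ℕ → Bool
isLRB bs ν w = semistandardB (zip bs w) ∧ contentB ν w ∧ latticeB (length ν) w

LRcoeff : List ℕ → List ℕ → List ℕ → ℕ
LRcoeff la mu ν =
  length (filterᵇ (isLRB (skewBoxes la mu) ν) (words (length ν) (length (skewBoxes la mu))))

-- [ν] appears in the skew character [λ/μ]
Appears : List ℕ → List ℕ → List ℕ → Set
Appears la mu ν = IsPartition ν × ¬ (LRcoeff la mu ν ≡ 0)

LexLeq : (ℕ → ℕ) → (ℕ → ℕ) → Set
LexLeq f g = (∀ k → f k ≡ g k)
           ⊎ (Σ ℕ λ k → (∀ i → i < k → f i ≡ g i) × (f k < g k))

IsHL : List ℕ → List ℕ → (ℕ → ℕ) → Set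
IsHL la mu h =
    (Σ (List ℕ) λ ν → Appears la mu ν × (∀ k → hl ν k ≡ h k))
  × (∀ ν → Appears la mu ν → LexLeq (hl ν) h)

{-# OPTIONS --safe #-}
module Submission where

open import Defs
open import Data.Bool using (Bool; true; false; T; _∧_; _∨_; not)
open import Data.Bool.Properties using (T-≡; T-∧; T-∨)
open import Data.Empty using (⊥-elim)
open import Data.List using (List; []; _∷_; _++_; length; map; concatMap; applyUpTo; applyDownFrom; filterᵇ; zip; inits; replicate; take; drop)
open import Data.List.Properties
open import Data.List.Membership.Propositional using (_∈_)
open import Data.List.Membership.Propositional.Properties
open import Data.List.Relation.Unary.All as All using (All; []; _∷_)
open import Data.List.Relation.Unary.All.Properties using (replicate⁺; ++⁺)
open import Data.List.Relation.Unary.AllPairs using (AllPairs; []; _∷_)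
open import Data.List.Relation.Unary.Any using (here; there)
open import Data.List.Relation.Unary.Linked using (Linked; []; [-]; _∷_)
open import Data.List.Relation.Unary.Linked.Properties using (Linked⇒AllPairs)
open import Data.Nat
open import Data.Nat.Properties
open import Data.Nat.Tactic.RingSolver using (solve-∀)
open import Data.Product using (Σ; ∃; ∃₂; _×_; _,_; proj₁; proj₂)
open import Data.Sum using (_⊎_; inj₁; inj₂)
open import Function using (_∘_; Equivalence)
open import Relation.Binary.PropositionalEquality
open import Relation.Nullary using (contradiction)

open Equivalence using (to; from)

-- For a partition ν let R k be the number of boxes (i , j) of ν with i , j > k, and for the
-- skew diagram A let S k be the number of boxes left after removing k northwest ribbons.
-- Then hl and πnw are the consecutive differences of R and S, and R 0 = S 0 = |A|, so the
-- lexicographic bound follows from R k ≥ S k, and equality from R = S.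
--
-- For R k ≥ S k, discard from a Littlewood–Richardson tableau the letters ≤ k and the first k
-- occurrences of every other letter. Exactly R k boxes remain. Column strictness puts all
-- letters ≤ k of row i at columns ≤ μ (i - k), and the lattice condition allows at most k of
-- the discarded occurrences in a row, so row i keeps at least λ i - k - μ (i - k) boxes.
--
-- For equality, remove from A the top box of every column and then the last box of every
-- nonempty row; this leaves a translate of A without its first northwest ribbon. Extend an
-- extremal tableau of the rest by writing 1 in the column tops, raising the other entries by
-- one, and writing r + 1 at the end of the r-th nonempty row. This adds to the content a
-- hook of length |nw₁ A|.

-- Finite sums of natural numbers.

sumTo : (ℕ → ℕ) → ℕ → ℕ
sumTo f zero    = 0
sumTo f (suc n) = sumTo f n + f n

sumTo-cong : ∀ {f g : ℕ → ℕ} n → (∀ i → i < n → f i ≡ g i) → sumTo f n ≡ sumTo g n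
sumTo-cong zero    eq = refl
sumTo-cong (suc n) eq =
  cong₂ _+_ (sumTo-cong n (λ i i<n → eq i (m<n⇒m<1+n i<n))) (eq n ≤-refl)

sumTo-mono : ∀ {f g : ℕ → ℕ} n → (∀ i → i < n → f i ≤ g i) → sumTo f n ≤ sumTo g n
sumTo-mono zero    le = z≤n
sumTo-mono (suc n) le =
  +-mono-≤ (sumTo-mono n (λ i i<n → le i (m<n⇒m<1+n i<n))) (le n ≤-refl)

sumTo-suc : ∀ (f : ℕ → ℕ) n → sumTo f (suc n) ≡ f 0 + sumTo (λ i → f (suc i)) n
sumTo-suc f zero    = +-comm 0 (f 0)
sumTo-suc f (suc n) = trans (cong (_+ f (suc n)) (sumTo-suc f n)) (+-assoc (f 0) _ _)

+-interchange : ∀ a b c d → (a + b) + (c + d) ≡ (a + c) + (b + d)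
+-interchange = solve-∀

sumTo-+ : ∀ (f g : ℕ → ℕ) n → sumTo (λ i → f i + g i) n ≡ sumTo f n + sumTo g n
sumTo-+ f g zero    = refl
sumTo-+ f g (suc n) = trans (cong (_+ (f n + g n)) (sumTo-+ f g n))
                            (+-interchange (sumTo f n) (sumTo g n) (f n) (g n))

sumTo-0 : ∀ {f : ℕ → ℕ} n → (∀ i → i < n → f i ≡ 0) → sumTo f n ≡ 0
sumTo-0 zero    eq = refl
sumTo-0 (suc n) eq =
  cong₂ _+_ (sumTo-0 n (λ i i<n → eq i (m<n⇒m<1+n i<n))) (eq n ≤-refl)

sumTo-* : ∀ c (f : ℕ → ℕ) n → sumTo (λ i → c * f i) n ≡ c * sumTo f n
sumTo-* c f zero    = sym (*-zeroʳ c)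
sumTo-* c f (suc n) = trans (cong (_+ c * f n) (sumTo-* c f n)) (sym (*-distribˡ-+ c _ _))

sumTo-split : ∀ (f : ℕ → ℕ) k n → sumTo f (k + n) ≡ sumTo f k + sumTo (λ i → f (k + i)) n
sumTo-split f zero    n = refl
sumTo-split f (suc k) n = begin
  sumTo f (suc (k + n))                                        ≡⟨ sumTo-suc f (k + n) ⟩
  f 0 + sumTo (λ i → f (suc i)) (k + n)                        ≡⟨ cong (f 0 +_) (sumTo-split (λ i → f (suc i)) k n) ⟩
  f 0 + (sumTo (λ i → f (suc i)) k + sumTo (λ i → f (suc k + i)) n) ≡⟨ +-assoc (f 0) _ _ ⟨
  f 0 + sumTo (λ i → f (suc i)) k + sumTo (λ i → f (suc k + i)) n ≡⟨ cong (_+ sumTo (λ i → f (suc k + i)) n) (sumTo-suc f k) ⟨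
  sumTo f (suc k) + sumTo (λ i → f (suc k + i)) n ∎
  where open ≡-Reasoning

sumTo-monoʳ : ∀ (f : ℕ → ℕ) {m n} → m ≤ n → sumTo f m ≤ sumTo f n
sumTo-monoʳ f {m} {n} m≤n = begin
  sumTo f m                                 ≤⟨ m≤m+n _ _ ⟩
  sumTo f m + sumTo (λ i → f (m + i)) (n ∸ m) ≡⟨ sumTo-split f m (n ∸ m) ⟨
  sumTo f (m + (n ∸ m))                     ≡⟨ cong (sumTo f) (m+[n∸m]≡n m≤n) ⟩
  sumTo f n ∎
  where open ≤-Reasoning

sumTo-≤-split : ∀ (f : ℕ → ℕ) k n → sumTo f n ≤ sumTo f k + sumTo (λ i → f (k + i)) (n ∸ k)
sumTo-≤-split f k n = begin
  sumTo f n             ≤⟨ sumTo-monoʳ f (m≤n+m∸n n k) ⟩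
  sumTo f (k + (n ∸ k)) ≡⟨ sumTo-split f k (n ∸ k) ⟩
  sumTo f k + sumTo (λ i → f (k + i)) (n ∸ k) ∎
  where open ≤-Reasoning

sumTo-stop : ∀ (f : ℕ → ℕ) {m n} → m ≤ n → (∀ i → m ≤ i → f i ≡ 0) → sumTo f n ≡ sumTo f m
sumTo-stop f {m} {n} m≤n zs = begin
  sumTo f n                                 ≡⟨ cong (sumTo f) (m+[n∸m]≡n m≤n) ⟨
  sumTo f (m + (n ∸ m))                     ≡⟨ sumTo-split f m (n ∸ m) ⟩
  sumTo f m + sumTo (λ i → f (m + i)) (n ∸ m) ≡⟨ cong (sumTo f m +_) (sumTo-0 (n ∸ m) (λ i _ → zs (m + i) (m≤m+n m i))) ⟩
  sumTo f m + 0                             ≡⟨ +-identityʳ _ ⟩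
  sumTo f m ∎
  where open ≡-Reasoning

-- Littlewood-Richardson tableaux as matrices of row contents.

-- A Littlewood–Richardson tableau of shape λ/μ is encoded by t i a, the number of entries
-- a + 1 in row i, with rows and letters counted from 0. Then pos i a is the last column of
-- row i with an entry ≤ a, and cnt i a is the number of entries a + 1 above row i.
pos : (ℕ → ℕ) → (ℕ → ℕ → ℕ) → ℕ → ℕ → ℕ
pos mu t i a = mu i + sumTo (t i) a

cnt : (ℕ → ℕ → ℕ) → ℕ → ℕ → ℕ
cnt t i a = sumTo (λ i' → t i' a) i

-- Column strictness: a letter at most `a + 1` in row `i + 1` must lie under a letter at most `a` of
-- row `i` or under a box of μ. Lattice condition: rows are read from right to left, so the letters
-- `a + 2` of row `i` come before its letters `a + 1`, and the tightest prefix ends just after them.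
record LRMatrix (n m : ℕ) (la mu : ℕ → ℕ) (t : ℕ → ℕ → ℕ) : Set where
  field
    row-full   : ∀ i → i < n → pos mu t i m ≡ la i
    col-strict : ∀ i a → suc i < n → pos mu t (suc i) (suc a) ≤ pos mu t i a
    lattice    : ∀ i a → i < n → cnt t (suc i) (suc a) ≤ cnt t i a

Decr : (ℕ → ℕ) → Set
Decr f = ∀ i → f (suc i) ≤ f i

-- The number of boxes (i , j) with i , j > k of the partition ν₀ ≥ ν₁ ≥ … with m parts;
-- consecutive differences are the diagonal hook lengths.
outerHook : ℕ → (ℕ → ℕ) → ℕ → ℕ
outerHook m ν k = sumTo (λ a → ν (k + a) ∸ k) (m ∸ k)

-- The number of boxes of λ/μ left after removing k northwest ribbons: (i , j) survives iff
-- (i - k , j - k) is a box as well, and row i is counted through its shift by k columns.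
inner : ℕ → (ℕ → ℕ) → (ℕ → ℕ) → ℕ → ℕ
inner n la mu k = sumTo (λ i → la (k + i) ∸ k ∸ mu i) (n ∸ k)

-- A letter `a + 2` in some row needs an `a + 1` in a strictly higher row, so each new letter costs
-- at least one more row.
cnt-0 : ∀ {n m la mu t} → LRMatrix n m la mu t → ∀ i a → i ≤ n → i ≤ a → cnt t i a ≡ 0
cnt-0 M zero    a       _    _     = refl
cnt-0 M (suc i) (suc a) i<n (s≤s i≤a) =
  n≤0⇒n≡0 (≤-trans (LRMatrix.lattice M i a i<n)
                   (≤-reflexive (cnt-0 M i a (<⇒≤ i<n) i≤a)))

cnt↓ : ∀ {n m la mu t} → LRMatrix n m la mu t → ∀ i → i ≤ n → Decr (cnt t i)
cnt↓ M zero    _   a = z≤n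
cnt↓ M (suc i) i<n a = ≤-trans (LRMatrix.lattice M i a i<n) (m≤m+n _ _)

entry-0 : ∀ {n m la mu t} → LRMatrix n m la mu t → ∀ i a → i < n → i < a → t i a ≡ 0
entry-0 {t = t} M i a i<n i<a = m+n≡0⇒n≡0 (cnt t i a) (cnt-0 M (suc i) a i<n i<a)

total : ∀ t m n → sumTo (cnt t n) m ≡ sumTo (λ i → sumTo (t i) m) n
total t m zero    = sumTo-0 m (λ _ _ → refl)
total t m (suc n) = trans (sumTo-+ (cnt t n) (t n) m) (cong (_+ sumTo (t n) m) (total t m n))

-- The bound `R k ≥ S k` for every tableau.

module UpperBound {n m la mu t} (M : LRMatrix n m la mu t) where
  open LRMatrix M

  -- Both sides count all boxes of λ/μ, once by letter and once by row.
  outer≡inner₀ : outerHook m (cnt t n) 0 ≡ inner n la mu 0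
  outer≡inner₀ = trans (total t m n) (sumTo-cong n λ i i<n →
    sym (trans (cong (_∸ mu i) (sym (row-full i i<n))) (m+n∸m≡n (mu i) _)))

  -- Only k of the letters in a row are among the first k occurrences of their value,
  -- because min k (cnt (suc i) (suc a)) ≤ min k (cnt i a) makes the sum telescope.
  row-step : ∀ k i → i < n → ∀ m' →
    sumTo (λ a → cnt t i (k + a) ∸ k) m' + sumTo (λ a → t i (k + a)) m' + k ⊓ cnt t (suc i) (k + m')
      ≤ sumTo (λ a → cnt t (suc i) (k + a) ∸ k) m' + k
  row-step k i i<n zero = m⊓n≤m k _
  row-step k i i<n (suc m') = +-cancelʳ-≤ (k ⊓ x) _ _ (begin
    Y + (y ∸ k) + (W + τ) + z' + k ⊓ x ≤⟨ +-monoˡ-≤ (k ⊓ x) (+-monoʳ-≤ (Y + (y ∸ k) + (W + τ)) z'≤) ⟩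
    Y + (y ∸ k) + (W + τ) + k ⊓ y + k ⊓ x ≡⟨ shuffle Y (y ∸ k) W τ (k ⊓ y) (k ⊓ x) ⟩
    (Y + W + k ⊓ x) + (k ⊓ y + (y ∸ k) + τ) ≡⟨ cong (λ u → (Y + W + k ⊓ x) + (u + τ)) (m⊓n+n∸m≡n k y) ⟩
    (Y + W + k ⊓ x) + x                     ≤⟨ +-monoˡ-≤ x (row-step k i i<n m') ⟩
    (X + k) + x                             ≡⟨ cong ((X + k) +_) (m⊓n+n∸m≡n k x) ⟨
    (X + k) + (k ⊓ x + (x ∸ k))             ≡⟨ shuffle' X k (k ⊓ x) (x ∸ k) ⟩
    X + (x ∸ k) + k + k ⊓ x ∎)
    where
    open ≤-Reasoning
    x = cnt t (suc i) (k + m')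
    y = cnt t i (k + m')
    τ = t i (k + m')
    Y = sumTo (λ a → cnt t i (k + a) ∸ k) m'
    W = sumTo (λ a → t i (k + a)) m'
    X = sumTo (λ a → cnt t (suc i) (k + a) ∸ k) m'
    z' = k ⊓ cnt t (suc i) (k + suc m')
    z'≤ : z' ≤ k ⊓ y
    z'≤ = ⊓-monoʳ-≤ k (subst (λ c → cnt t (suc i) c ≤ y) (sym (+-suc k m')) (lattice i (k + m') i<n))
    shuffle : ∀ a b c d e f → a + b + (c + d) + e + f ≡ (a + c + f) + (e + b + d)
    shuffle = solve-∀
    shuffle' : ∀ a b c d → (a + b) + (c + d) ≡ a + d + b + c
    shuffle' = solve-∀

  -- Going up one row lowers the bound on the letters by one; after `k` rows no letter is left and
  -- only the columns of μ remain.
  pos-diag : ∀ k i → k + i < n → pos mu t (k + i) k ≤ mu i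
  pos-diag zero    i _   = ≤-reflexive (+-identityʳ (mu i))
  pos-diag (suc k) i k<n = ≤-trans (col-strict (k + i) k k<n) (pos-diag k i (<-trans (n<1+n _) k<n))

  -- Induction on the rows: when row `k + n'` is added, the left side grows by the surviving boxes
  -- of that row. Its letters at most `k` lie within `mu n'` columns, and by `row-step` all but `k`
  -- of the larger letters contribute to the growth of the right side.
  rows-bound : ∀ k n' → k + n' ≤ n →
    sumTo (λ i → la (k + i) ∸ k ∸ mu i) n' ≤ outerHook m (cnt t (k + n')) k
  rows-bound k zero     _  = z≤n
  rows-bound k (suc n') le = begin
    sumTo s n' + s n' ≤⟨ +-monoˡ-≤ (s n') (rows-bound k n' (<⇒≤ i<n)) ⟩
    -- The component `Y ≤ X` of `key` takes care of the case where the truncated difference is cut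
    -- off at zero.
    Y + (la i ∸ k ∸ mu n') ≤⟨ m+[n∸k∸l]≤ Y (la i) k (mu n') X key ⟩
    X ≡⟨ cong (λ j → outerHook m (cnt t j) k) (+-suc k n') ⟨
    outerHook m (cnt t (k + suc n')) k ∎
    where
    open ≤-Reasoning
    i = k + n'
    s = λ i → la (k + i) ∸ k ∸ mu i
    i<n : i < n
    i<n = subst (_≤ n) (+-suc k n') le
    Y = outerHook m (cnt t i) k
    X = outerHook m (cnt t (suc i)) k
    W = sumTo (λ a → t i (k + a)) (m ∸ k)
    Y≤X : Y ≤ X
    Y≤X = sumTo-mono (m ∸ k) λ a _ → ∸-monoˡ-≤ k (m≤m+n (cnt t i (k + a)) _)
    YT≤X : Y + W ≤ X + k
    YT≤X = ≤-trans (m≤m+n (Y + W) _) (row-step k i i<n (m ∸ k))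
    key : (Y ≤ X) × (Y + la i ≤ X + k + mu n')
    key = Y≤X , (begin
      Y + la i ≡⟨ cong (Y +_) (row-full i i<n) ⟨
      Y + (mu i + sumTo (t i) m) ≤⟨ +-monoʳ-≤ Y (+-monoʳ-≤ (mu i) (sumTo-≤-split (t i) k m)) ⟩
      Y + (mu i + (sumTo (t i) k + W)) ≡⟨ cong (Y +_) (+-assoc (mu i) _ W) ⟨
      Y + (pos mu t i k + W) ≤⟨ +-monoʳ-≤ Y (+-monoˡ-≤ W (pos-diag k n' i<n)) ⟩
      Y + (mu n' + W) ≡⟨ swap Y (mu n') W ⟩
      Y + W + mu n' ≤⟨ +-monoˡ-≤ (mu n') YT≤X ⟩
      X + k + mu n' ∎)
      where
      swap : ∀ a b c → a + (b + c) ≡ a + c + b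
      swap = solve-∀
    m+[n∸k∸l]≤ : ∀ y n k l x → (y ≤ x) × (y + n ≤ x + k + l) → y + (n ∸ k ∸ l) ≤ x
    m+[n∸k∸l]≤ y n k l x (y≤x , le) = ≤-trans (+-monoʳ-≤ y (begin
      n ∸ k ∸ l ≡⟨ ∸-+-assoc n k l ⟩
      n ∸ (k + l) ≤⟨ ∸-monoˡ-≤ (k + l) n≤ ⟩
      x ∸ y + (k + l) ∸ (k + l) ≡⟨ m+n∸n≡m (x ∸ y) (k + l) ⟩
      x ∸ y ∎)) (≤-reflexive (m+[n∸m]≡n y≤x))
      where
      n≤ : n ≤ x ∸ y + (k + l)
      n≤ = +-cancelˡ-≤ y _ _ (begin
        y + n ≤⟨ le ⟩
        x + k + l ≡⟨ +-assoc x k l ⟩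
        x + (k + l) ≡⟨ cong (_+ (k + l)) (m+[n∸m]≡n y≤x) ⟨
        y + (x ∸ y) + (k + l) ≡⟨ +-assoc y _ _ ⟩
        y + (x ∸ y + (k + l)) ∎)

  inner≤outer : ∀ k → inner n la mu k ≤ outerHook m (cnt t n) k
  inner≤outer k with ≤-total k n
  ... | inj₁ k≤n = subst (λ j → inner n la mu k ≤ outerHook m (cnt t j) k) (m+[n∸m]≡n k≤n)
                     (rows-bound k (n ∸ k) (≤-reflexive (m+[n∸m]≡n k≤n)))
  ... | inj₂ n≤k = ≤-trans (≤-reflexive (cong (sumTo _) (m≤n⇒m∸n≡0 n≤k))) z≤n

-- Numerical indicators of order and equality.

⟦_<_⟧ : ℕ → ℕ → ℕ
⟦ _     < zero  ⟧ = 0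
⟦ zero  < suc _ ⟧ = 1
⟦ suc a < suc b ⟧ = ⟦ a < b ⟧

⟦_≐_⟧ : ℕ → ℕ → ℕ
⟦ zero  ≐ zero  ⟧ = 1
⟦ zero  ≐ suc _ ⟧ = 0
⟦ suc _ ≐ zero  ⟧ = 0
⟦ suc a ≐ suc b ⟧ = ⟦ a ≐ b ⟧

⟦<⟧-view : ∀ a b → (⟦ a < b ⟧ ≡ 1 × a < b) ⊎ (⟦ a < b ⟧ ≡ 0 × b ≤ a)
⟦<⟧-view a       zero    = inj₂ (refl , z≤n)
⟦<⟧-view zero    (suc b) = inj₁ (refl , s≤s z≤n)
⟦<⟧-view (suc a) (suc b) with ⟦<⟧-view a b
... | inj₁ (e , a<b) = inj₁ (e , s≤s a<b)
... | inj₂ (e , b≤a) = inj₂ (e , s≤s b≤a)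

⟦<⟧-≤1 : ∀ a b → ⟦ a < b ⟧ ≤ 1
⟦<⟧-≤1 a       zero    = z≤n
⟦<⟧-≤1 zero    (suc b) = ≤-refl
⟦<⟧-≤1 (suc a) (suc b) = ⟦<⟧-≤1 a b

⟦<⟧-1 : ∀ {a b} → a < b → ⟦ a < b ⟧ ≡ 1
⟦<⟧-1 {zero}  (s≤s _)   = refl
⟦<⟧-1 {suc a} (s≤s a<b) = ⟦<⟧-1 a<b

⟦<⟧-mono : ∀ a {b c} → b ≤ c → ⟦ a < b ⟧ ≤ ⟦ a < c ⟧
⟦<⟧-mono a       z≤n     = z≤n
⟦<⟧-mono zero    (s≤s _) = ≤-refl
⟦<⟧-mono (suc a) (s≤s p) = ⟦<⟧-mono a p

⟦<⟧-suc : ∀ a b → ⟦ a < suc b ⟧ ≡ ⟦ a < b ⟧ + ⟦ a ≐ b ⟧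
⟦<⟧-suc zero    zero    = refl
⟦<⟧-suc zero    (suc b) = refl
⟦<⟧-suc (suc a) zero    = refl
⟦<⟧-suc (suc a) (suc b) = ⟦<⟧-suc a b

⟦≐⟧-sym : ∀ a b → ⟦ a ≐ b ⟧ ≡ ⟦ b ≐ a ⟧
⟦≐⟧-sym zero    zero    = refl
⟦≐⟧-sym zero    (suc b) = refl
⟦≐⟧-sym (suc a) zero    = refl
⟦≐⟧-sym (suc a) (suc b) = ⟦≐⟧-sym a b

sumTo-≐ : ∀ r n → sumTo (λ a → ⟦ a ≐ r ⟧) n ≡ ⟦ r < n ⟧
sumTo-≐ r zero    = refl
sumTo-≐ r (suc n) = trans (cong₂ _+_ (sumTo-≐ r n) (⟦≐⟧-sym n r)) (sym (⟦<⟧-suc r n))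

Decr-≤ : ∀ {f} → Decr f → ∀ k i → f (k + i) ≤ f i
Decr-≤ d zero    i = ≤-refl
Decr-≤ d (suc k) i = ≤-trans (d (k + i)) (Decr-≤ d k i)

Decr-mono : ∀ {f} → Decr f → ∀ {i j} → i ≤ j → f j ≤ f i
Decr-mono {f} f↓ {i} i≤j = subst (λ z → f z ≤ f i) (m∸n+n≡m i≤j) (Decr-≤ f↓ _ i)

-- Adding a hook to the content of an extremal tableau.

-- hat-la and hat-mu describe λ/μ without its column tops and row ends (v i = 1 iff a box of
-- row i + 1 has one above it). The first row of that diagram is empty and is dropped.
module Extend (n : ℕ) (la mu : ℕ → ℕ) (la↓ : Decr la) (mu↓ : Decr mu) (mu≤la : ∀ i → mu i ≤ la i) where

  v : ℕ → ℕ
  v i = ⟦ mu i < la (suc i) ⟧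

  hat-la hat-mu : ℕ → ℕ
  hat-la i = la (suc i) ∸ v i
  hat-mu i = la (suc i) ⊓ mu i

  hat-la↓ : Decr hat-la
  hat-la↓ i with ⟦<⟧-view (mu i) (la (suc i)) | ⟦<⟧-view (mu (suc i)) (la (suc (suc i)))
  ... | inj₂ (e , _) | _ rewrite e = ≤-trans (m∸n≤m (la (suc (suc i))) (v (suc i))) (la↓ (suc i))
  ... | inj₁ (e , _) | inj₁ (e' , _) rewrite e | e' = ∸-monoˡ-≤ 1 (la↓ (suc i))
  -- The only delicate case, where a row loses its end and the next row does not: here `la (i + 2) ≤
  -- mu (i + 1) ≤ mu i < la (i + 1)`, which leaves room for the lost box.
  ... | inj₁ (e , p) | inj₂ (e' , q) rewrite e | e' =
        ∸-monoˡ-≤ 1 (≤-trans (s≤s (≤-trans q (mu↓ i))) p)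

  hat-mu↓ : Decr hat-mu
  hat-mu↓ i = ⊓-mono-≤ (la↓ (suc i)) (mu↓ i)

  hat-mu≤hat-la : ∀ i → hat-mu i ≤ hat-la i
  hat-mu≤hat-la i with ⟦<⟧-view (mu i) (la (suc i))
  ... | inj₁ (e , p) rewrite e = ≤-trans (m⊓n≤n (la (suc i)) (mu i)) (∸-monoˡ-≤ 1 p)
  ... | inj₂ (e , _) rewrite e = m⊓n≤m (la (suc i)) (mu i)

  mu≤hat-mu : ∀ i → mu (suc i) ≤ hat-mu i
  mu≤hat-mu i = ⊓-glb (mu≤la (suc i)) (mu↓ i)

  -- The reduced diagram is a translate of λ/μ without its first northwest ribbon, checked row by
  -- row. If `v (k + i)` is 1 and `mu i ≤ la (i + 1)`, the two terms are the same difference.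
  -- Otherwise `la (k + 1 + i)` is at most both `mu i` and `la (i + 1)`, so both terms vanish.
  inner-hat : ∀ k → inner (suc n) la mu (suc k) ≡ inner n hat-la hat-mu k
  inner-hat k = sumTo-cong (n ∸ k) λ i _ → term i
    where
    term : ∀ i → la (suc k + i) ∸ suc k ∸ mu i ≡ hat-la (k + i) ∸ k ∸ hat-mu i
    term i with ⟦<⟧-view (mu (k + i)) (la (suc (k + i)))
    ... | inj₁ (e , p) rewrite e with ≤-total (mu i) (la (suc i))
    ...   | inj₁ q rewrite m≥n⇒m⊓n≡n q = cong (_∸ mu i) (sym (∸-+-assoc (la (suc k + i)) 1 k))
    ...   | inj₂ q rewrite m≤n⇒m⊓n≡m q = trans
            (m≤n⇒m∸n≡0 (≤-trans (m∸n≤m (la (suc k + i)) (suc k)) (≤-trans la≤ q)))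
            (sym (m≤n⇒m∸n≡0 (≤-trans (m∸n≤m _ k) (≤-trans (m∸n≤m (la (suc k + i)) 1) la≤))))
      where
      la≤ : la (suc k + i) ≤ la (suc i)
      la≤ = subst (λ j → la j ≤ la (suc i)) (+-suc k i) (Decr-≤ {la} la↓ k (suc i))
    term i | inj₂ (e , p) rewrite e = trans
        (m≤n⇒m∸n≡0 (≤-trans (m∸n≤m (la (suc k + i)) (suc k)) la≤mu))
        (sym (m≤n⇒m∸n≡0 (≤-trans (m∸n≤m (la (suc k + i)) k) (⊓-glb la≤ la≤mu))))
      where
      la≤ : la (suc k + i) ≤ la (suc i)
      la≤ = subst (λ j → la j ≤ la (suc i)) (+-suc k i) (Decr-≤ {la} la↓ k (suc i))
      la≤mu : la (suc k + i) ≤ mu i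
      la≤mu = ≤-trans p (Decr-≤ {mu} mu↓ k i)

  rank : ℕ → ℕ
  rank = sumTo v

  -- The box put back at the end of a nonempty row. As `rank` numbers these rows from 0 and `t`
  -- below uses `e` with the letter index raised by one, the r-th of them ends in the letter
  -- `r + 1`.
  e : ℕ → ℕ → ℕ
  e i a = v i * ⟦ a ≐ rank i ⟧

  v≤1 : ∀ i → v i ≤ 1
  v≤1 i = ⟦<⟧-≤1 (mu i) (la (suc i))

  rank≤ : ∀ i → rank i ≤ i
  rank≤ zero    = z≤n
  rank≤ (suc i) = ≤-trans (+-mono-≤ (rank≤ i) (v≤1 i)) (≤-reflexive (+-comm i 1))

  sum-e-row : ∀ i a → sumTo (e i) a ≡ v i * ⟦ rank i < a ⟧
  sum-e-row i a = trans (sumTo-* (v i) _ a) (cong (v i *_) (sumTo-≐ (rank i) a))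

  sum-e-col : ∀ a i → sumTo (λ i' → e i' a) i ≡ ⟦ a < rank i ⟧
  sum-e-col a zero    = refl
  sum-e-col a (suc i) with ⟦<⟧-view (mu i) (la (suc i))
  ... | inj₁ (q , _) rewrite q | +-comm (rank i) 1 =
        trans (cong₂ _+_ (sum-e-col a i) (+-identityʳ _)) (sym (⟦<⟧-suc a (rank i)))
  ... | inj₂ (q , _) rewrite q | +-identityʳ (rank i) = trans (+-identityʳ _) (sum-e-col a i)

  module _ {t̂ : ℕ → ℕ → ℕ} (M : LRMatrix n n hat-la hat-mu t̂) where
    open LRMatrix M

    -- Every box of the first row tops its column; in row `i + 1` the column tops are the boxes up
    -- to column `hat-mu i`. These boxes hold the ones.
    t : ℕ → ℕ → ℕ
    t zero    zero    = la 0 ∸ mu 0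
    t zero    (suc a) = 0
    t (suc i) zero    = hat-mu i ∸ mu (suc i)
    t (suc i) (suc a) = t̂ i a + e i a

    cnt-t : ∀ i a → cnt t (suc i) (suc a) ≡ cnt t̂ i a + ⟦ a < rank i ⟧
    cnt-t i a = begin
      cnt t (suc i) (suc a)                     ≡⟨ sumTo-suc (λ i' → t i' (suc a)) i ⟩
      sumTo (λ i' → t̂ i' a + e i' a) i          ≡⟨ sumTo-+ (λ i' → t̂ i' a) (λ i' → e i' a) i ⟩
      cnt t̂ i a + sumTo (λ i' → e i' a) i       ≡⟨ cong (cnt t̂ i a +_) (sum-e-col a i) ⟩
      cnt t̂ i a + ⟦ a < rank i ⟧ ∎
      where open ≡-Reasoning

    pos-t : ∀ i a → pos mu t (suc i) (suc a) ≡ pos hat-mu t̂ i a + v i * ⟦ rank i < a ⟧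
    pos-t i a = begin
      mu (suc i) + sumTo (t (suc i)) (suc a)
        ≡⟨ cong (mu (suc i) +_) (sumTo-suc (t (suc i)) a) ⟩
      mu (suc i) + (hat-mu i ∸ mu (suc i) + sumTo (λ a → t̂ i a + e i a) a)
        ≡⟨ +-assoc (mu (suc i)) _ _ ⟨
      mu (suc i) + (hat-mu i ∸ mu (suc i)) + sumTo (λ a → t̂ i a + e i a) a
        ≡⟨ cong₂ _+_ (m+[n∸m]≡n (mu≤hat-mu i)) (sumTo-+ (t̂ i) (e i) a) ⟩
      hat-mu i + (sumTo (t̂ i) a + sumTo (e i) a)
        ≡⟨ +-assoc (hat-mu i) _ _ ⟨
      pos hat-mu t̂ i a + sumTo (e i) a
        ≡⟨ cong (pos hat-mu t̂ i a +_) (sum-e-row i a) ⟩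
      pos hat-mu t̂ i a + v i * ⟦ rank i < a ⟧ ∎
      where open ≡-Reasoning

    t-pos₁ : ∀ i → pos mu t (suc i) 1 ≡ hat-mu i
    t-pos₁ i = m+[n∸m]≡n (mu≤hat-mu i)

    row-full-t : ∀ i → i < suc n → pos mu t i (suc n) ≡ la i
    row-full-t zero    _ = begin
      mu 0 + sumTo (t 0) (suc n)                            ≡⟨ cong (mu 0 +_) (sumTo-suc (t 0) n) ⟩
      mu 0 + (la 0 ∸ mu 0 + sumTo (λ _ → 0) n)              ≡⟨ cong (λ z → mu 0 + (la 0 ∸ mu 0 + z)) (sumTo-0 n (λ _ _ → refl)) ⟩
      mu 0 + (la 0 ∸ mu 0 + 0)                              ≡⟨ cong (mu 0 +_) (+-identityʳ _) ⟩
      mu 0 + (la 0 ∸ mu 0)                                  ≡⟨ m+[n∸m]≡n (mu≤la 0) ⟩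
      la 0 ∎
      where open ≡-Reasoning
    row-full-t (suc i) (s≤s i<n) = begin
      pos mu t (suc i) (suc n)                 ≡⟨ pos-t i n ⟩
      pos hat-mu t̂ i n + v i * ⟦ rank i < n ⟧  ≡⟨ cong₂ (λ x y → x + v i * y) (row-full i i<n) (⟦<⟧-1 (≤-<-trans (rank≤ i) i<n)) ⟩
      hat-la i + v i * 1                       ≡⟨ cong (hat-la i +_) (*-identityʳ (v i)) ⟩
      hat-la i + v i                           ≡⟨ m∸n+n≡m v≤la ⟩
      la (suc i) ∎
      where
      open ≡-Reasoning
      v≤la : v i ≤ la (suc i)
      v≤la with ⟦<⟧-view (mu i) (la (suc i))
      ... | inj₁ (q , p) = ≤-trans (≤-reflexive q) (≤-trans (s≤s z≤n) p)
      ... | inj₂ (q , _) = ≤-trans (≤-reflexive q) z≤n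

    entry-0-t : ∀ i → i < suc n → ∀ a → suc n ≤ a → t i a ≡ 0
    entry-0-t zero    _         (suc a) _         = refl
    entry-0-t (suc i) (s≤s i<n) (suc a) (s≤s n≤a) =
      cong₂ _+_ (entry-0 M i a i<n (<-≤-trans i<n n≤a)) (trans (cong (v i *_) ≐-0) (*-zeroʳ (v i)))
      where
      ≐-0 : ⟦ a ≐ rank i ⟧ ≡ 0
      ≐-0 = m+n≡0⇒n≡0 ⟦ a < rank i ⟧ (trans (sym (⟦<⟧-suc a (rank i))) lt0)
        where
        lt0 : ⟦ a < suc (rank i) ⟧ ≡ 0
        lt0 with ⟦<⟧-view a (suc (rank i))
        ... | inj₂ (q , _) = q
        ... | inj₁ (_ , s≤s p) = contradiction (≤-trans i<n (≤-trans n≤a (≤-trans p (rank≤ i)))) (<-irrefl refl)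

    pos≤la : ∀ i → i < suc n → ∀ a → pos mu t i a ≤ la i
    pos≤la i i<n a with ≤-total a (suc n)
    ... | inj₁ a≤n = ≤-trans (+-monoʳ-≤ (mu i) (sumTo-monoʳ (t i) a≤n)) (≤-reflexive (row-full-t i i<n))
    ... | inj₂ n≤a = ≤-reflexive (trans (cong (mu i +_) (sumTo-stop (t i) n≤a (entry-0-t i i<n))) (row-full-t i i<n))

    col-strict-t : ∀ i a → suc i < suc n → pos mu t (suc i) (suc a) ≤ pos mu t i a
    -- The ones of row `i + 1` are column tops, hence lie under μ.
    col-strict-t i       zero    _ =
      ≤-trans (≤-reflexive (t-pos₁ i)) (≤-trans (m⊓n≤n (la (suc i)) (mu i)) (m≤m+n _ _))
    -- The first row consists of ones only, so `pos` already reaches its end `la 0` there.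
    col-strict-t zero    (suc a) p = begin
      pos mu t 1 (suc (suc a)) ≤⟨ pos≤la 1 p (suc (suc a)) ⟩
      la 1                     ≤⟨ la↓ 0 ⟩
      la 0                     ≡⟨ m+[n∸m]≡n (mu≤la 0) ⟨
      mu 0 + (la 0 ∸ mu 0)     ≤⟨ +-monoʳ-≤ (mu 0) (sumTo-monoʳ (t 0) (s≤s (z≤n {a}))) ⟩
      pos mu t 0 (suc a) ∎
      where open ≤-Reasoning
    col-strict-t (suc i) (suc a) p@(s≤s q) with ⟦<⟧-view (mu i) (la (suc i))
    -- Row `i + 1` consists of column tops only, so its ones fill it up to `la (i + 1)`, and the
    -- next row is no longer.
    ... | inj₂ (_ , le) = begin
      pos mu t (suc (suc i)) (suc (suc a)) ≤⟨ pos≤la (suc (suc i)) p (suc (suc a)) ⟩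
      la (suc (suc i))                     ≤⟨ la↓ (suc i) ⟩
      la (suc i)                           ≡⟨ m≤n⇒m⊓n≡m le ⟨
      hat-mu i                             ≤⟨ m≤m+n _ _ ⟩
      pos hat-mu t̂ i a                     ≤⟨ m≤m+n _ _ ⟩
      pos hat-mu t̂ i a + v i * ⟦ rank i < a ⟧ ≡⟨ pos-t i a ⟨
      pos mu t (suc i) (suc a) ∎
      where open ≤-Reasoning
    -- Row `i + 1` has an end letter, which raises the rank by one; an end letter in the next row is
    -- therefore larger by one, as column strictness demands.
    ... | inj₁ (v1 , _) = begin
      pos mu t (suc (suc i)) (suc (suc a)) ≡⟨ pos-t (suc i) (suc a) ⟩
      pos hat-mu t̂ (suc i) (suc a) + v (suc i) * ⟦ rank i + v i < suc a ⟧
        ≤⟨ +-mono-≤ (col-strict i a q) (*-mono-≤ (v≤1 (suc i)) (≤-reflexive (cong (λ z → ⟦ z < suc a ⟧) (trans (cong (rank i +_) v1) (+-comm (rank i) 1))))) ⟩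
      pos hat-mu t̂ i a + 1 * ⟦ rank i < a ⟧ ≡⟨ cong (λ z → pos hat-mu t̂ i a + z * ⟦ rank i < a ⟧) v1 ⟨
      pos hat-mu t̂ i a + v i * ⟦ rank i < a ⟧ ≡⟨ pos-t i a ⟨
      pos mu t (suc i) (suc a) ∎
      where open ≤-Reasoning

    -- Gives the lattice condition for the letters 1 and 2 row by row. If `mu i ≤ la (i + 1)`, the
    -- twos start right after column `mu i`, and column strictness puts them below ones. Otherwise
    -- row `i + 1` holds only ones.
    twos≤ones : ∀ i → suc i < suc n → t (suc i) 1 ≤ t i 0
    twos≤ones i p = +-cancelˡ-≤ (hat-mu i) _ _ (begin
      hat-mu i + t (suc i) 1 ≡⟨ cong (_+ t (suc i) 1) (t-pos₁ i) ⟨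
      pos mu t (suc i) 1 + t (suc i) 1 ≡⟨ +-assoc (mu (suc i)) _ _ ⟩
      pos mu t (suc i) 2 ≤⟨ bound ⟩
      hat-mu i + t i 0 ∎)
      where
      open ≤-Reasoning
      bound : pos mu t (suc i) 2 ≤ hat-mu i + t i 0
      bound with ≤-total (mu i) (la (suc i))
      ... | inj₁ q = ≤-trans (col-strict-t i 1 p) (≤-reflexive (cong (_+ t i 0) (sym (m≥n⇒m⊓n≡n q))))
      ... | inj₂ q = ≤-trans (pos≤la (suc i) p 2) (≤-trans (≤-reflexive (sym (m≤n⇒m⊓n≡m q))) (m≤m+n _ _))

    lattice-t : ∀ i a → i < suc n → cnt t (suc i) (suc a) ≤ cnt t i a
    lattice-t i zero p = begin
      cnt t (suc i) 1            ≡⟨ sumTo-suc (λ i' → t i' 1) i ⟩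
      sumTo (λ i' → t (suc i') 1) i ≤⟨ sumTo-mono i (λ i' i'<i → twos≤ones i' (≤-<-trans i'<i p)) ⟩
      cnt t i 0 ∎
      where open ≤-Reasoning
    lattice-t zero (suc a) p = z≤n
    lattice-t (suc i) (suc a) (s≤s p) = begin
      cnt t (suc (suc i)) (suc (suc a))           ≡⟨ cnt-t (suc i) (suc a) ⟩
      cnt t̂ (suc i) (suc a) + ⟦ suc a < rank (suc i) ⟧
        ≤⟨ +-mono-≤ (lattice i a p) (⟦<⟧-mono (suc a) (≤-trans (+-monoʳ-≤ (rank i) (v≤1 i)) (≤-reflexive (+-comm (rank i) 1)))) ⟩
      cnt t̂ i a + ⟦ a < rank i ⟧                  ≡⟨ cnt-t i a ⟨
      cnt t (suc i) (suc a) ∎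
      where open ≤-Reasoning

    -- Sharpens `cnt-0` from all rows to the rows with `v i` equal to 1: the other rows of the
    -- reduced diagram are empty and cannot introduce a new letter. It ensures that the content has
    -- at most `rank n` nonzero parts, so that the end letters extend every one of them.
    cnt-rank-0 : ∀ i a → i ≤ n → rank i ≤ a → cnt t̂ i a ≡ 0
    cnt-rank-0 zero    a _   _ = refl
    cnt-rank-0 (suc i) a i<n r≤a with ⟦<⟧-view (mu i) (la (suc i))
    cnt-rank-0 (suc i) zero i<n r≤a | inj₁ (v1 , _) =
      contradiction (≤-trans (≤-reflexive (sym v1)) (≤-trans (m≤n+m (v i) (rank i)) r≤a)) λ ()
    cnt-rank-0 (suc i) (suc a) i<n r≤a | inj₁ (v1 , _) =
      n≤0⇒n≡0 (≤-trans (lattice i a i<n) (≤-reflexive (cnt-rank-0 i a (<⇒≤ i<n)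
        (s≤s⁻¹ (≤-trans (≤-reflexive (trans (+-comm 1 (rank i)) (cong (rank i +_) (sym v1)))) r≤a)))))
    cnt-rank-0 (suc i) a i<n r≤a | inj₂ (v0 , le) =
      cong₂ _+_ (cnt-rank-0 i a (<⇒≤ i<n) (≤-trans (m≤m+n _ _) r≤a)) t0
      where
      row0 : sumTo (t̂ i) n ≡ 0
      row0 = +-cancelˡ-≡ (hat-mu i) _ _ (begin
        hat-mu i + sumTo (t̂ i) n ≡⟨ row-full i i<n ⟩
        la (suc i) ∸ v i         ≡⟨ cong (la (suc i) ∸_) v0 ⟩
        la (suc i)               ≡⟨ m≤n⇒m⊓n≡m le ⟨
        hat-mu i                 ≡⟨ +-identityʳ _ ⟨
        hat-mu i + 0 ∎)
        where open ≡-Reasoning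
      t0 : t̂ i a ≡ 0
      t0 with ≤-<-connex n a
      ... | inj₁ n≤a = entry-0 M i a i<n (<-≤-trans i<n n≤a)
      ... | inj₂ a<n = n≤0⇒n≡0 (≤-trans (m≤n+m (t̂ i a) (sumTo (t̂ i) a))
                         (≤-trans (sumTo-monoʳ (t̂ i) a<n) (≤-reflexive row0)))

    extended : LRMatrix (suc n) (suc n) la mu t
    extended = record { row-full = row-full-t ; col-strict = col-strict-t ; lattice = lattice-t }

    -- The ones become a new first part, and each old part with index below `rank n` gains one box
    -- from an end letter. The remaining old parts are zero, so cutting off one more row and column
    -- removes exactly the added hook.
    outer-hat : ∀ k → outerHook (suc n) (cnt t (suc n)) (suc k) ≡ outerHook n (cnt t̂ n) k
    outer-hat k = sumTo-cong (n ∸ k) λ a _ → trans (cong (_∸ suc k) (cnt-t n (k + a))) (term (k + a))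
      where
      term : ∀ b → cnt t̂ n b + ⟦ b < rank n ⟧ ∸ suc k ≡ cnt t̂ n b ∸ k
      term b with ⟦<⟧-view b (rank n)
      ... | inj₁ (q , _) rewrite q | +-comm (cnt t̂ n b) 1 = refl
      ... | inj₂ (q , r≤b) rewrite q | cnt-rank-0 n b ≤-refl r≤b = sym (0∸n≡0 k)

∃-extremal : ∀ n la mu → Decr la → Decr mu → (∀ i → mu i ≤ la i) →
  Σ (ℕ → ℕ → ℕ) λ t → LRMatrix n n la mu t × (∀ k → outerHook n (cnt t n) k ≡ inner n la mu k)
∃-extremal zero la mu la↓ mu↓ mu≤la =
  (λ _ _ → 0) ,
  record { row-full = λ _ () ; col-strict = λ _ _ () ; lattice = λ _ _ () } ,
  λ k → trans (cong (sumTo (λ _ → 0 ∸ k)) (0∸n≡0 k)) (sym (cong (sumTo (λ i → la (k + i) ∸ k ∸ mu i)) (0∸n≡0 k)))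
∃-extremal (suc n) la mu la↓ mu↓ mu≤la with
  ∃-extremal n hat-la hat-mu hat-la↓ hat-mu↓ hat-mu≤hat-la
  where open Extend n la mu la↓ mu↓ mu≤la
... | t̂ , M , eq = t M , extended M , outer≡inner
  where
  open Extend n la mu la↓ mu↓ mu≤la
  outer≡inner : ∀ k → outerHook (suc n) (cnt (t M) (suc n)) k ≡ inner (suc n) la mu k
  -- At `k = 0` both sides are the number of boxes, so the size of the added hook need not be
  -- computed.
  outer≡inner zero    = UpperBound.outer≡inner₀ (extended M)
  outer≡inner (suc k) = trans (outer-hat M k) (trans (eq k) (sym (inner-hat k)))

-- Filtered lists and diagrams listed row by row.

T-ext : ∀ {x y} → (T x → T y) → (T y → T x) → x ≡ y
T-ext {true}  {true}  f g = refl
T-ext {true}  {false} f g = ⊥-elim (f _)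
T-ext {false} {true}  f g = ⊥-elim (g _)
T-ext {false} {false} f g = refl

module _ {A : Set} where

  filterᵇ-cong-∈ : ∀ {p q : A → Bool} xs → (∀ x → x ∈ xs → p x ≡ q x) → filterᵇ p xs ≡ filterᵇ q xs
  filterᵇ-cong-∈ []       eq = refl
  filterᵇ-cong-∈ {p} {q} (x ∷ xs) eq with p x | q x | eq x (here refl)
  ... | true  | .true  | refl = cong (x ∷_) (filterᵇ-cong-∈ xs (λ y y∈ → eq y (there y∈)))
  ... | false | .false | refl = filterᵇ-cong-∈ xs (λ y y∈ → eq y (there y∈))

  filterᵇ-filterᵇ : ∀ (p q : A → Bool) xs → filterᵇ p (filterᵇ q xs) ≡ filterᵇ (λ x → q x ∧ p x) xs
  filterᵇ-filterᵇ p q []       = refl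
  filterᵇ-filterᵇ p q (x ∷ xs) with q x
  ... | false = filterᵇ-filterᵇ p q xs
  ... | true with p x
  ...   | true  = cong (x ∷_) (filterᵇ-filterᵇ p q xs)
  ...   | false = filterᵇ-filterᵇ p q xs

  filterᵇ-true : ∀ (xs : List A) → filterᵇ (λ _ → true) xs ≡ xs
  filterᵇ-true []       = refl
  filterᵇ-true (x ∷ xs) = cong (x ∷_) (filterᵇ-true xs)

  length-filterᵇ-not : ∀ {p q : A → Bool} → (∀ x → q x ≡ not (p x)) → ∀ xs →
    length (filterᵇ q xs) + length (filterᵇ p xs) ≡ length xs
  length-filterᵇ-not eq []       = refl
  length-filterᵇ-not {p} {q} eq (x ∷ xs) with p x | q x | eq x
  ... | true  | .false | refl = trans (+-suc _ _) (cong suc (length-filterᵇ-not eq xs))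
  ... | false | .true  | refl = cong suc (length-filterᵇ-not eq xs)

  length-filterᵇ-++ : ∀ (p : A → Bool) xs ys →
    length (filterᵇ p (xs ++ ys)) ≡ length (filterᵇ p xs) + length (filterᵇ p ys)
  length-filterᵇ-++ p xs ys = trans (cong length (filter-++ _ xs ys)) (length-++ (filterᵇ p xs))

  length-filterᵇ-applyDownFrom : ∀ (p : A → Bool) f d → (∀ c → p (f c) ≡ (d ≤ᵇ c)) →
    ∀ n → length (filterᵇ p (applyDownFrom f n)) ≡ n ∸ d
  length-filterᵇ-applyDownFrom p f d eq zero    = sym (0∸n≡0 d)
  length-filterᵇ-applyDownFrom p f d eq (suc n) with p (f n) | eq n
  ... | true  | q = trans (cong suc (length-filterᵇ-applyDownFrom p f d eq n))
                          (sym (+-∸-assoc 1 (≤ᵇ⇒≤ d n (from T-≡ (sym q)))))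
  ... | false | q with ≤-<-connex d n
  ...   | inj₁ d≤n = contradiction (≤⇒≤ᵇ d≤n) (subst T (sym q))
  ...   | inj₂ n<d = trans (length-filterᵇ-applyDownFrom p f d eq n)
                       (trans (m≤n⇒m∸n≡0 (<⇒≤ n<d)) (sym (m≤n⇒m∸n≡0 n<d)))

  -- Recursion on the last row runs parallel to `sumTo` and makes the rows above a given one a
  -- prefix.
  catRows : (ℕ → List A) → ℕ → List A
  catRows r zero    = []
  catRows r (suc n) = catRows r n ++ r n

  concatMap-applyUpTo : ∀ {B : Set} (g : B → List A) (f : ℕ → B) n →
    concatMap g (applyUpTo f n) ≡ catRows (g ∘ f) n
  concatMap-applyUpTo g f zero    = refl
  concatMap-applyUpTo g f (suc n) = begin
    concatMap g (applyUpTo f (suc n))                  ≡⟨ cong (concatMap g) (applyUpTo-∷ʳ f n) ⟨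
    concatMap g (applyUpTo f n ++ f n ∷ [])            ≡⟨ concatMap-++ g (applyUpTo f n) _ ⟩
    concatMap g (applyUpTo f n) ++ concatMap g (f n ∷ []) ≡⟨ cong₂ _++_ (concatMap-applyUpTo g f n) (++-identityʳ (g (f n))) ⟩
    catRows (g ∘ f) n ++ g (f n) ∎
    where open ≡-Reasoning

  catRows-cong : ∀ {r r' : ℕ → List A} → (∀ i → r i ≡ r' i) → ∀ n → catRows r n ≡ catRows r' n
  catRows-cong eq zero    = refl
  catRows-cong eq (suc n) = cong₂ _++_ (catRows-cong eq n) (eq n)

  ∈-catRows⁺ : ∀ (r : ℕ → List A) {x} i n → i < n → x ∈ r i → x ∈ catRows r n
  ∈-catRows⁺ r i (suc n) i<1+n x∈ with m≤n⇒m<n∨m≡n (s≤s⁻¹ i<1+n)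
  ... | inj₁ i<n  = ∈-++⁺ˡ (∈-catRows⁺ r i n i<n x∈)
  ... | inj₂ refl = ∈-++⁺ʳ (catRows r n) x∈

  ∈-catRows⁻ : ∀ (r : ℕ → List A) {x} n → x ∈ catRows r n → ∃ λ i → i < n × x ∈ r i
  ∈-catRows⁻ r (suc n) x∈ with ∈-++⁻ (catRows r n) x∈
  ... | inj₁ x∈ˡ = let i , i<n , x∈i = ∈-catRows⁻ r n x∈ˡ in i , m<n⇒m<1+n i<n , x∈i
  ... | inj₂ x∈ʳ = n , ≤-refl , x∈ʳ

  length-filterᵇ-catRows : ∀ (p : A → Bool) r n →
    length (filterᵇ p (catRows r n)) ≡ sumTo (λ i → length (filterᵇ p (r i))) n
  length-filterᵇ-catRows p r zero    = refl
  length-filterᵇ-catRows p r (suc n) =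
    trans (length-filterᵇ-++ p (catRows r n) (r n)) (cong (_+ length (filterᵇ p (r n))) (length-filterᵇ-catRows p r n))

-- Counting the boxes that survive the removal of northwest ribbons.

memB⁺ : ∀ {b} xs → b ∈ xs → T (memB b xs)
memB⁺ {i , j} (_ ∷ xs) (here refl) = from T-∨ (inj₁ (from T-∧ (≡⇒≡ᵇ i i refl , ≡⇒≡ᵇ j j refl)))
memB⁺ (_ ∷ xs) (there b∈)  = from T-∨ (inj₂ (memB⁺ xs b∈))

memB⁻ : ∀ {b} xs → T (memB b xs) → b ∈ xs
memB⁻ {i , j} ((i' , j') ∷ xs) m with to (T-∨ {boxEq (i , j) (i' , j')}) m
... | inj₁ e = let p , q = to T-∧ e in here (cong₂ _,_ (≡ᵇ⇒≡ i i' p) (≡ᵇ⇒≡ j j' q))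
... | inj₂ m' = there (memB⁻ xs m')

πnw-iterNw : ∀ A k → πnw A k + length (iterNw (suc k) A) ≡ length (iterNw k A)
πnw-iterNw A k = length-filterᵇ-not (λ _ → refl) (iterNw k A)

part : List ℕ → ℕ → ℕ
part la i = rowLen la (suc i)

rowBoxes : (ℕ → ℕ) → (ℕ → ℕ) → ℕ → List Box
rowBoxes la mu i = applyDownFrom (λ c → suc i , suc (mu i + c)) (la i ∸ mu i)

boxes : ℕ → (ℕ → ℕ) → (ℕ → ℕ) → List Box
boxes n la mu = catRows (rowBoxes la mu) n

skewBoxes-boxes : ∀ la mu → skewBoxes la mu ≡ boxes (length la) (part la) (part mu)
skewBoxes-boxes la mu = trans (concatMap-applyUpTo _ suc (length la))
  (catRows-cong (λ i → reverse-applyUpTo _ (part la i ∸ part mu i)) (length la))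

module _ {n : ℕ} {la mu : ℕ → ℕ} where

  ∈-boxes⁺ : ∀ i j → i < n → mu i < j → j ≤ la i → (suc i , j) ∈ boxes n la mu
  ∈-boxes⁺ i (suc j) i<n (s≤s mu≤j) j<la = ∈-catRows⁺ (rowBoxes la mu) i n i<n
    (subst (λ c → (suc i , suc c) ∈ rowBoxes la mu i) (m+[n∸m]≡n mu≤j)
      (∈-applyDownFrom⁺ _ (∸-monoˡ-< j<la mu≤j)))

  ∈-boxes⁻ : ∀ {b} → b ∈ boxes n la mu →
    ∃ λ i → proj₁ b ≡ suc i × i < n × mu i < proj₂ b × proj₂ b ≤ la i
  ∈-boxes⁻ b∈ with ∈-catRows⁻ (rowBoxes la mu) n b∈
  ... | i , i<n , b∈i with ∈-applyDownFrom⁻ _ b∈i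
  ... | c , c< , refl = i , refl , i<n , s≤s (m≤m+n (mu i) c) ,
        ≤-trans (≤-reflexive (sym (+-suc (mu i) c)))
          (≤-trans (+-monoʳ-≤ (mu i) c<) (≤-reflexive (m+[n∸m]≡n {mu i} (<⇒≤ (m∸n≢0⇒n<m λ e → n≮0 (subst (c <_) e c<))))))

-- For a box `(i , j)` of λ/μ this says that `(i - k , j - k)` is a box too; that it stays inside λ
-- is automatic. Box rows count from 1 and `mu` from 0, hence `suc k`.
deep : (ℕ → ℕ) → ℕ → Box → Bool
deep mu k (i , j) = (k <ᵇ i) ∧ (mu (i ∸ suc k) + k <ᵇ j)

module _ {n : ℕ} {la mu : ℕ → ℕ} (la↓ : Decr la) (mu↓ : Decr mu) where

  private
    A = boxes n la mu

  -- A box survives one more removal iff its northwest neighbour is still present, and stepping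
  -- northwest turns depth `k + 1` into depth `k`.
  iterNw-deep : ∀ k → iterNw k A ≡ filterᵇ (deep mu k) A
  iterNw-deep zero    = sym (trans (filterᵇ-cong-∈ A (λ x → all-deep x)) (filterᵇ-true A))
    where
    all-deep : ∀ x → x ∈ A → deep mu 0 x ≡ true
    all-deep (i , j) x∈ with ∈-boxes⁻ {n} {la} {mu} x∈
    ... | i' , refl , _ , mu<j , _ = to T-≡ (<⇒<ᵇ (subst (_< j) (sym (+-identityʳ (mu i'))) mu<j))
  iterNw-deep (suc k) rewrite iterNw-deep k =
    trans (filterᵇ-filterᵇ _ (deep mu k) A) (filterᵇ-cong-∈ A (λ x → step x))
    where
    step : ∀ x → x ∈ A →
      deep mu k x ∧ memB (proj₁ x ∸ 1 , proj₂ x ∸ 1) (filterᵇ (deep mu k) A) ≡ deep mu (suc k) x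
    step (i , zero) x∈ with ∈-boxes⁻ {n} {la} {mu} x∈
    ... | _ , _ , _ , () , _
    step (i , suc j) x∈ with ∈-boxes⁻ {n} {la} {mu} x∈
    ... | i' , refl , i'<n , mu<j , j≤la = T-ext ⇒ ⇐
      where
      ⇒ : T (deep mu k (suc i' , suc j) ∧ memB (i' , j) (filterᵇ (deep mu k) A)) → T (deep mu (suc k) (suc i' , suc j))
      ⇒ h with ∈-filter⁻ _ {xs = A} (memB⁻ (filterᵇ (deep mu k) A) (proj₂ (to (T-∧ {deep mu k (suc i' , suc j)}) h)))
      ... | _ , d with to (T-∧ {k <ᵇ i'}) d
      ... | d₁ , d₂ = from T-∧ (d₁ , <⇒<ᵇ (subst (_< suc j) (sym (+-suc _ k)) (s≤s (<ᵇ⇒< _ j d₂))))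
      ⇐ : T (deep mu (suc k) (suc i' , suc j)) → T (deep mu k (suc i' , suc j) ∧ memB (i' , j) (filterᵇ (deep mu k) A))
      ⇐ h with to (T-∧ {k <ᵇ i'}) h
      ... | d₁ , d₂ = from (T-∧ {deep mu k (suc i' , suc j)}) (from (T-∧ {k <ᵇ suc i'}) (<⇒<ᵇ (m<n⇒m<1+n k<i') , <⇒<ᵇ here-deep) ,
                       memB⁺ _ (∈-filter⁺ _ (prev i' k<i' i'<n j≤la μ<j) (from T-∧ (d₁ , <⇒<ᵇ μ<j))))
        where
        k<i' : k < i'
        k<i' = <ᵇ⇒< k i' d₁
        μ<j : mu (i' ∸ suc k) + k < j
        μ<j = s≤s⁻¹ (subst (_< suc j) (+-suc _ k) (<ᵇ⇒< _ (suc j) d₂))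
        here-deep : mu (i' ∸ k) + k < suc j
        here-deep = ≤-<-trans (+-monoˡ-≤ k (Decr-mono mu↓ (∸-monoʳ-≤ i' (n≤1+n k)))) (m<n⇒m<1+n μ<j)
        -- The neighbour lies on the diagonal between two boxes of the diagram, hence in the
        -- diagram.
        prev : ∀ i' → k < i' → i' < n → suc j ≤ la i' → mu (i' ∸ suc k) + k < j → (i' , j) ∈ A
        prev (suc i) (s≤s k≤i) i<n j≤ μ< = ∈-boxes⁺ i j (<⇒≤ i<n)
          (≤-<-trans (≤-trans (Decr-mono mu↓ (m∸n≤m i k)) (m≤m+n _ k)) μ<) (≤-trans (<⇒≤ j≤) (la↓ i))

  row-deep : ∀ k i → length (filterᵇ (deep mu k) (rowBoxes la mu (k + i))) ≡ la (k + i) ∸ k ∸ mu i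
  row-deep k i = begin
    length (filterᵇ (deep mu k) (rowBoxes la mu (k + i)))
      ≡⟨ length-filterᵇ-applyDownFrom (deep mu k) _ d eq (la (k + i) ∸ mu (k + i)) ⟩
    la (k + i) ∸ mu (k + i) ∸ d   ≡⟨ ∸-+-assoc (la (k + i)) (mu (k + i)) d ⟩
    la (k + i) ∸ (mu (k + i) + d) ≡⟨ cong (la (k + i) ∸_) (trans (m+[n∸m]≡n mu≤) (+-comm (mu i) k)) ⟩
    la (k + i) ∸ (k + mu i)       ≡⟨ ∸-+-assoc (la (k + i)) k (mu i) ⟨
    la (k + i) ∸ k ∸ mu i ∎
    where
    open ≡-Reasoning
    d = mu i + k ∸ mu (k + i)
    mu≤ : mu (k + i) ≤ mu i + k
    mu≤ = ≤-trans (Decr-≤ mu↓ k i) (m≤m+n _ k)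
    eq : ∀ c → deep mu k (suc (k + i) , suc (mu (k + i) + c)) ≡ (d ≤ᵇ c)
    eq c rewrite m+n∸m≡n k i = T-ext
      (λ h → ≤⇒≤ᵇ (m≤n+o⇒m∸n≤o (mu i + k) (mu (k + i)) (s≤s⁻¹ (<ᵇ⇒< (mu i + k) _ (proj₂ (to (T-∧ {k <ᵇ suc (k + i)}) h))))))
      (λ h → from (T-∧ {k <ᵇ suc (k + i)}) (<⇒<ᵇ (s≤s (m≤m+n k i)) ,
        <⇒<ᵇ (s≤s (≤-trans (≤-reflexive (sym (m+[n∸m]≡n mu≤))) (+-monoʳ-≤ (mu (k + i)) (≤ᵇ⇒≤ d c h))))))

  row-shallow : ∀ k i → i < k → length (filterᵇ (deep mu k) (rowBoxes la mu i)) ≡ 0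
  row-shallow k i i<k = cong length (filter-none _ (All.tabulate none))
    where
    none : ∀ {x} → x ∈ rowBoxes la mu i → T (deep mu k x) → _
    none x∈ h with ∈-applyDownFrom⁻ _ x∈
    ... | c , _ , refl = <⇒≱ i<k (s≤s⁻¹ (<ᵇ⇒< k (suc i) (proj₁ (to (T-∧ {k <ᵇ suc i}) h))))

  length-iterNw : ∀ k → length (iterNw k A) ≡ inner n la mu k
  length-iterNw k = trans (cong length (iterNw-deep k))
    (trans (length-filterᵇ-catRows (deep mu k) (rowBoxes la mu) n) sums)
    where
    g : ℕ → ℕ
    g i = length (filterᵇ (deep mu k) (rowBoxes la mu i))
    sums : sumTo g n ≡ inner n la mu k
    sums with ≤-total k n
    ... | inj₁ k≤n = begin
      sumTo g n             ≡⟨ cong (sumTo g) (m+[n∸m]≡n k≤n) ⟨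
      sumTo g (k + (n ∸ k)) ≡⟨ sumTo-split g k (n ∸ k) ⟩
      sumTo g k + sumTo (λ i → g (k + i)) (n ∸ k)
        ≡⟨ cong₂ _+_ (sumTo-0 k (row-shallow k)) (sumTo-cong (n ∸ k) (λ i _ → row-deep k i)) ⟩
      inner n la mu k ∎
      where open ≡-Reasoning
    ... | inj₂ n≤k = trans (sumTo-0 n (λ i i<n → row-shallow k i (<-≤-trans i<n n≤k)))
                           (cong (sumTo (λ i → la (k + i) ∸ k ∸ mu i)) (sym (m≤n⇒m∸n≡0 n≤k)))

-- Diagonal hook lengths and lexicographic comparison.

part↓ : ∀ ν → IsPartition ν → Decr (part ν)
part↓ []           _         i       = z≤n
part↓ (x ∷ [])     _         i       = z≤n
part↓ (x ∷ y ∷ xs) (y≤x , _) zero    = y≤x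
part↓ (x ∷ y ∷ xs) (_ , p)   (suc i) = part↓ (y ∷ xs) p i

part-0 : ∀ ν i → length ν ≤ i → part ν i ≡ 0
part-0 []       i       _       = refl
part-0 (x ∷ ν) (suc i) (s≤s p) = part-0 ν i p

colLen-sumTo : ∀ ν k → colLen ν (suc k) ≡ sumTo (λ a → ⟦ k < part ν a ⟧) (length ν)
colLen-sumTo []      k = refl
colLen-sumTo (x ∷ ν) k = trans colLen-∷ (trans (cong (⟦ k < x ⟧ +_) (colLen-sumTo ν k))
                                           (sym (sumTo-suc (λ a → ⟦ k < part (x ∷ ν) a ⟧) (length ν))))
  where
  colLen-∷ : colLen (x ∷ ν) (suc k) ≡ ⟦ k < x ⟧ + colLen ν (suc k)
  colLen-∷ with k <ᵇ x in eq | ⟦<⟧-view k x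
  ... | true  | inj₁ (q , _)   rewrite q = refl
  ... | false | inj₂ (q , _)   rewrite q = refl
  ... | true  | inj₂ (_ , x≤k) = contradiction (<ᵇ⇒< k x (from T-≡ eq)) (≤⇒≯ x≤k)
  ... | false | inj₁ (_ , k<x) = contradiction (<⇒<ᵇ k<x) (subst T eq)

∸-suc-⟦<⟧ : ∀ x k → x ∸ k ≡ (x ∸ suc k) + ⟦ k < x ⟧
∸-suc-⟦<⟧ zero    zero    = refl
∸-suc-⟦<⟧ zero    (suc k) = refl
∸-suc-⟦<⟧ (suc x) zero    = +-comm 1 x
∸-suc-⟦<⟧ (suc x) (suc k) = ∸-suc-⟦<⟧ x k

-- The boxes beyond row and column `k` are the hook of the next diagonal box and the boxes beyond
-- `k + 1`. In the sum, `f k ∸ k` is the corner with its arm and `C` is the leg. If the diagonal box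
-- is absent, both regions are empty.
hl-outerHook : ∀ ν → IsPartition ν → ∀ k →
  hl ν k + outerHook (length ν) (part ν) (suc k) ≡ outerHook (length ν) (part ν) k
hl-outerHook ν pν k with suc k ≤ᵇ rowLen ν (suc k) in eq
... | true = begin
    suc ((f k ∸ suc k) + (colLen ν (suc k) ∸ suc k)) + O
      ≡⟨ cong (λ c → suc (f k ∸ suc k + (c ∸ suc k)) + O) col ⟩
    suc ((f k ∸ suc k) + (suc k + C ∸ suc k)) + O
      ≡⟨ cong₂ (λ x y → x + y + O) (sym (+-∸-assoc 1 k<fk)) (m+n∸m≡n (suc k) C) ⟩
    (f k ∸ k) + C + O
      ≡⟨ +-assoc (f k ∸ k) C O ⟩
    (f k ∸ k) + (C + O)
      ≡⟨ cong₂ _+_ (cong (λ z → f z ∸ k) (sym (+-identityʳ k))) (trans (+-comm C O) (sym (sumTo-+ (λ a → f (suc k + a) ∸ suc k) (λ a → ⟦ k < f (suc k + a) ⟧) M))) ⟩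
    (f (k + 0) ∸ k) + sumTo (λ a → (f (suc k + a) ∸ suc k) + ⟦ k < f (suc k + a) ⟧) M
      ≡⟨ cong ((f (k + 0) ∸ k) +_) (sumTo-cong M λ a _ → trans (sym (∸-suc-⟦<⟧ (f (suc k + a)) k)) (cong (λ z → f z ∸ k) (sym (+-suc k a)))) ⟩
    (f (k + 0) ∸ k) + sumTo (λ a → f (k + suc a) ∸ k) M
      ≡⟨ sumTo-suc (λ a → f (k + a) ∸ k) M ⟨
    sumTo (λ a → f (k + a) ∸ k) (suc M)
      ≡⟨ cong (sumTo (λ a → f (k + a) ∸ k)) (+-∸-assoc 1 k<m) ⟨
    outerHook (length ν) f k ∎
    where
    open ≡-Reasoning
    f = part ν
    M = length ν ∸ suc k
    O = outerHook (length ν) f (suc k)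
    C = sumTo (λ a → ⟦ k < f (suc k + a) ⟧) M
    k<fk : k < f k
    k<fk = ≤ᵇ⇒≤ (suc k) (f k) (from T-≡ eq)
    k<m : k < length ν
    k<m with ≤-<-connex (length ν) k
    ... | inj₁ m≤k = contradiction (subst (k <_) (part-0 ν k m≤k) k<fk) n≮0
    ... | inj₂ k<m = k<m
    ones : ∀ n → n ≤ suc k → sumTo (λ a → ⟦ k < f a ⟧) n ≡ n
    ones zero    _   = refl
    ones (suc n) n≤k = trans (cong₂ _+_ (ones n (<⇒≤ n≤k)) (⟦<⟧-1 (<-≤-trans k<fk (Decr-mono (part↓ ν pν) (s≤s⁻¹ n≤k))))) (+-comm n 1)
    -- The first `k + 1` rows are all longer than `k`, because row `k` is.
    col : colLen ν (suc k) ≡ suc k + C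
    col = trans (colLen-sumTo ν k) (trans (cong (sumTo _) (sym (m+[n∸m]≡n k<m)))
            (trans (sumTo-split (λ a → ⟦ k < f a ⟧) (suc k) M) (cong (_+ C) (ones (suc k) ≤-refl))))
... | false = trans (sumTo-0 (length ν ∸ suc k) λ a _ → small (suc k) a (n≤1+n k)) (sym (sumTo-0 (length ν ∸ k) λ a _ → small k a ≤-refl))
    where
    f = part ν
    fk≤k : f k ≤ k
    fk≤k with ≤-<-connex (f k) k
    ... | inj₁ p = p
    ... | inj₂ p = contradiction (≤⇒≤ᵇ p) (subst T eq)
    small : ∀ k' a → k ≤ k' → f (k' + a) ∸ k' ≡ 0
    small k' a k≤k' = m≤n⇒m∸n≡0 (≤-trans (Decr-mono (part↓ ν pν) (≤-trans k≤k' (m≤m+n k' a))) (≤-trans fk≤k k≤k'))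

-- Equal totals and `G 1 ≤ F 1` force `f 0 ≤ g 0`. If this is an equality, the tails at 1 have equal
-- totals again and the argument repeats; `K` bounds the number of repetitions, which makes the case
-- distinction constructive.
LexLeq-tails : ∀ K (f g F G : ℕ → ℕ) →
  (∀ k → f k + F (suc k) ≡ F k) → (∀ k → g k + G (suc k) ≡ G k) →
  (∀ k → G k ≤ F k) → F 0 ≡ G 0 → (∀ k → K ≤ k → F k ≡ 0) → LexLeq f g
LexLeq-tails zero f g F G fF gG G≤F eq F0 = inj₁ λ k → trans
  (m+n≡0⇒m≡0 (f k) (trans (fF k) (F0 k z≤n)))
  (sym (m+n≡0⇒m≡0 (g k) (trans (gG k) (n≤0⇒n≡0 (≤-trans (G≤F k) (≤-reflexive (F0 k z≤n)))))))
LexLeq-tails (suc K) f g F G fF gG G≤F eq F0 with m≤n⇒m<n∨m≡n f0≤g0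
  where
  f0≤g0 : f 0 ≤ g 0
  f0≤g0 = +-cancelʳ-≤ (F 1) _ _ (≤-trans (≤-reflexive (trans (fF 0) (trans eq (sym (gG 0)))))
                                         (+-monoʳ-≤ (g 0) (G≤F 1)))
... | inj₁ f0<g0 = inj₂ (0 , (λ _ ()) , f0<g0)
... | inj₂ f0≡g0 with LexLeq-tails K (f ∘ suc) (g ∘ suc) (F ∘ suc) (G ∘ suc) (fF ∘ suc) (gG ∘ suc) (G≤F ∘ suc) F1≡G1
                        (λ k K≤k → F0 (suc k) (s≤s K≤k))
  where
  F1≡G1 : F 1 ≡ G 1
  F1≡G1 = +-cancelˡ-≡ (f 0) _ _ (trans (fF 0) (trans eq (trans (sym (gG 0)) (cong (_+ G 1) (sym f0≡g0)))))
...   | inj₁ all = inj₁ λ { zero → f0≡g0 ; (suc k) → all k }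
...   | inj₂ (k , before , lt) = inj₂ (suc k , (λ { zero _ → f0≡g0 ; (suc i) (s≤s i<k) → before i i<k }) , lt)

-- Reading the Boolean tests and the lists of words.

T-imp⁺ : ∀ {x y} → (T x → T y) → T (not x ∨ y)
T-imp⁺ {true}  f = f _
T-imp⁺ {false} f = _

T-imp⁻ : ∀ {x y} → T (not x ∨ y) → T x → T y
T-imp⁻ {true} h _ = h

allB⁺ : ∀ {A : Set} {p : A → Bool} xs → (∀ x → x ∈ xs → T (p x)) → T (allB p xs)
allB⁺ []       f = _
allB⁺ (x ∷ xs) f = from T-∧ (f x (here refl) , allB⁺ xs (λ y y∈ → f y (there y∈)))

allB⁻ : ∀ {A : Set} {p : A → Bool} xs → T (allB p xs) → ∀ x → x ∈ xs → T (p x)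
allB⁻ {p = p} (x ∷ xs) h _ (here refl) = proj₁ (to (T-∧ {p x}) h)
allB⁻ {p = p} (x ∷ xs) h y (there y∈) = allB⁻ xs (proj₂ (to (T-∧ {p x}) h)) y y∈

SemiStd : List (Box × ℕ) → Set
SemiStd cs = ∀ i j x i' j' y → ((i , j) , x) ∈ cs → ((i' , j') , y) ∈ cs →
  (i' ≡ i → j' ≡ suc j → x ≤ y) × (i' ≡ suc i → j' ≡ j → x < y)

semistandardB⁻ : ∀ cs → T (semistandardB cs) → SemiStd cs
semistandardB⁻ cs h i j x i' j' y x∈ y∈
  with to (T-∧ {not ((i' ≡ᵇ i) ∧ (j' ≡ᵇ suc j)) ∨ (x ≤ᵇ y)}) (allB⁻ cs (allB⁻ cs h _ x∈) _ y∈)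
... | r , c =
  (λ p q → ≤ᵇ⇒≤ x y (T-imp⁻ r (from T-∧ (≡⇒≡ᵇ i' i p , ≡⇒≡ᵇ j' (suc j) q)))) ,
  (λ p q → <ᵇ⇒< x y (T-imp⁻ c (from T-∧ (≡⇒≡ᵇ i' (suc i) p , ≡⇒≡ᵇ j' j q))))

semistandardB⁺ : ∀ cs → SemiStd cs → T (semistandardB cs)
semistandardB⁺ cs s = allB⁺ cs λ { ((i , j) , x) x∈ → allB⁺ cs λ { ((i' , j') , y) y∈ →
  let r , c = s i j x i' j' y x∈ y∈ in
  from T-∧
    ( T-imp⁺ (λ h → let p , q = to (T-∧ {i' ≡ᵇ i}) h in ≤⇒≤ᵇ (r (≡ᵇ⇒≡ i' i p) (≡ᵇ⇒≡ j' (suc j) q)))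
    , T-imp⁺ (λ h → let p , q = to (T-∧ {i' ≡ᵇ suc i}) h in <⇒<ᵇ (c (≡ᵇ⇒≡ i' (suc i) p) (≡ᵇ⇒≡ j' j q)))) } }

Letter : ℕ → ℕ → Set
Letter m x = 1 ≤ x × x ≤ m

words⁻ : ∀ m n {w} → w ∈ words m n → length w ≡ n × All (Letter m) w
words⁻ m zero    (here refl) = refl , []
words⁻ m (suc n) w∈ with ∈-concat⁻′ (map (λ w → map (_∷ w) (applyUpTo suc m)) (words m n)) w∈
... | ws , w∈ws , ws∈ with ∈-map⁻ (λ w → map (_∷ w) (applyUpTo suc m)) ws∈
... | w' , w'∈ , refl with ∈-map⁻ (_∷ w') w∈ws
... | a , a∈ , refl with ∈-applyUpTo⁻ suc a∈
... | b , b<m , refl =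
  let l , ls = words⁻ m n w'∈ in cong suc l , (s≤s z≤n , b<m) ∷ ls

words⁺ : ∀ m {w} → All (Letter m) w → w ∈ words m (length w)
words⁺ m []                                = here refl
words⁺ m {suc b ∷ w} ((_ , b<m) ∷ ls) =
  ∈-concat⁺′ (∈-map⁺ (_∷ w) (∈-applyUpTo⁺ suc b<m)) (∈-map⁺ _ (words⁺ m ls))

inits⁺ : ∀ {A : Set} (p s : List A) → p ∈ inits (p ++ s)
inits⁺ []      s = here refl
inits⁺ (x ∷ p) s with inits⁺ p s
... | here refl = there (here refl)
... | there p∈  = there (there (∈-map⁺ (x ∷_) p∈))

inits⁻ : ∀ {A : Set} (w : List A) {p} → p ∈ inits w → ∃ λ s → w ≡ p ++ s
inits⁻ w       (here refl) = w , refl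
inits⁻ (x ∷ w) (there (here refl)) = w , refl
inits⁻ (x ∷ w) (there (there p∈)) with ∈-map⁻ (x ∷_) p∈
... | p' , p'∈ , refl = let s , eq = inits⁻ w (there p'∈) in s , cong (x ∷_) eq

LRcoeff⁻ : ∀ la mu ν → LRcoeff la mu ν ≢ 0 →
  ∃ λ w → w ∈ words (length ν) (length (skewBoxes la mu)) × T (isLRB (skewBoxes la mu) ν w)
LRcoeff⁻ la mu ν ≢0 with filterᵇ (isLRB (skewBoxes la mu) ν) (words (length ν) (length (skewBoxes la mu))) in eq
... | []    = contradiction refl ≢0
... | w ∷ _ = w , ∈-filter⁻ _ (subst (w ∈_) (sym eq) (here refl))

LRcoeff⁺ : ∀ la mu ν w → w ∈ words (length ν) (length (skewBoxes la mu)) →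
  T (isLRB (skewBoxes la mu) ν w) → LRcoeff la mu ν ≢ 0
LRcoeff⁺ la mu ν w w∈ h eq = n≮0 (subst (0 <_) eq (∈-length (∈-filter⁺ _ w∈ h)))

-- Cutting a word into rows.

zip-++ : ∀ {A B : Set} (xs : List A) {xs'} (ys : List B) {ys'} → length xs ≡ length ys →
  zip (xs ++ xs') (ys ++ ys') ≡ zip xs ys ++ zip xs' ys'
zip-++ []       []       _  = refl
zip-++ (x ∷ xs) (y ∷ ys) eq = cong ((x , y) ∷_) (zip-++ xs ys (suc-injective eq))

length-catRows : ∀ {A : Set} (r : ℕ → List A) n → length (catRows r n) ≡ sumTo (length ∘ r) n
length-catRows r zero    = refl
length-catRows r (suc n) = trans (length-++ (catRows r n)) (cong (_+ length (r n)) (length-catRows r n))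

zip-catRows : ∀ {A B : Set} (r : ℕ → List A) (s : ℕ → List B) n → (∀ i → i < n → length (r i) ≡ length (s i)) →
  zip (catRows r n) (catRows s n) ≡ catRows (λ i → zip (r i) (s i)) n
zip-catRows r s zero    eq = refl
zip-catRows r s (suc n) eq = trans
  (zip-++ (catRows r n) (catRows s n)
    (trans (length-catRows r n) (trans (sumTo-cong n (λ i i<n → eq i (m<n⇒m<1+n i<n))) (sym (length-catRows s n)))))
  (cong (_++ zip (r n) (s n)) (zip-catRows r s n (λ i i<n → eq i (m<n⇒m<1+n i<n))))

take-+ : ∀ {A : Set} m n (xs : List A) → take (m + n) xs ≡ take m xs ++ take n (drop m xs)
take-+ zero    n xs       = refl
take-+ (suc m) n []       = sym (take-[] n)
take-+ (suc m) n (x ∷ xs) = cong (x ∷_) (take-+ m n xs)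

module _ {A : Set} (len : ℕ → ℕ) (w : List A) where

  chunk : ℕ → List A
  chunk i = take (len i) (drop (sumTo len i) w)

  catRows-chunk : ∀ n → catRows chunk n ≡ take (sumTo len n) w
  catRows-chunk zero    = refl
  catRows-chunk (suc n) = trans (cong (_++ chunk n) (catRows-chunk n)) (sym (take-+ (sumTo len n) (len n) w))

  length-chunk : ∀ n → length w ≡ sumTo len n → ∀ i → i < n → length (chunk i) ≡ len i
  length-chunk n eq i i<n = begin
    length (chunk i)                          ≡⟨ length-take (len i) (drop (sumTo len i) w) ⟩
    len i ⊓ length (drop (sumTo len i) w)     ≡⟨ cong (len i ⊓_) (length-drop (sumTo len i) w) ⟩
    len i ⊓ (length w ∸ sumTo len i)          ≡⟨ m≤n⇒m⊓n≡m (m+n≤o⇒m≤o∸n (len i)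
      (≤-trans (≤-reflexive (+-comm (len i) _)) (≤-trans (sumTo-monoʳ len i<n) (≤-reflexive (sym eq))))) ⟩
    len i ∎
    where open ≡-Reasoning

  catRows-chunk-all : ∀ n → length w ≡ sumTo len n → catRows chunk n ≡ w
  catRows-chunk-all n eq = trans (catRows-chunk n) (take-all (sumTo len n) w (≤-reflexive eq))

catRows-prefix : ∀ {A : Set} (r : ℕ → List A) {i n} → i ≤ n → ∃ λ s → catRows r n ≡ catRows r i ++ s
catRows-prefix r {i} {zero} z≤n = [] , refl
catRows-prefix r {i} {suc n} i≤ with m≤n⇒m<n∨m≡n i≤
... | inj₂ refl = [] , sym (++-identityʳ _)
... | inj₁ (s≤s i≤n) = let s , eq = catRows-prefix r i≤n in
      s ++ r n , trans (cong (_++ r n) eq) (++-assoc (catRows r i) s (r n))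

-- Counting letters in words and rows.

≐-≡ᵇ : ∀ a b → (a ≡ᵇ b) ≡ true × ⟦ a ≐ b ⟧ ≡ 1 ⊎ (a ≡ᵇ b) ≡ false × ⟦ a ≐ b ⟧ ≡ 0
≐-≡ᵇ zero    zero    = inj₁ (refl , refl)
≐-≡ᵇ zero    (suc b) = inj₂ (refl , refl)
≐-≡ᵇ (suc a) zero    = inj₂ (refl , refl)
≐-≡ᵇ (suc a) (suc b) = ≐-≡ᵇ a b

count-∷ : ∀ a x w → count a (x ∷ w) ≡ ⟦ x ≐ a ⟧ + count a w
count-∷ a x w with x ≡ᵇ a | ⟦ x ≐ a ⟧ | ≐-≡ᵇ x a
... | .true  | .1 | inj₁ (refl , refl) = refl
... | .false | .0 | inj₂ (refl , refl) = refl

count-++ : ∀ a u w → count a (u ++ w) ≡ count a u + count a w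
count-++ a u w = length-filterᵇ-++ _ u w

count-none : ∀ a {w} → All (_≢ a) w → count a w ≡ 0
count-none a []         = refl
count-none a {x ∷ w} (x≢a ∷ ps) = trans (count-∷ a x w) (cong₂ _+_ x≐a (count-none a ps))
  where
  x≐a : ⟦ x ≐ a ⟧ ≡ 0
  x≐a with ≐-≡ᵇ x a
  ... | inj₁ (e , _) = contradiction (≡ᵇ⇒≡ x a (from T-≡ e)) x≢a
  ... | inj₂ (_ , e) = e

rowCount : List ℕ → ℕ → ℕ
rowCount r a = count (suc a) r

-- Written as a sum over letters so that `pos` of the matrix of a word is `mu i + smaller a (r i)`
-- by definition.
smaller : ℕ → List ℕ → ℕ
smaller a r = sumTo (rowCount r) a

smaller-∷ : ∀ a c r → smaller a (suc c ∷ r) ≡ ⟦ c < a ⟧ + smaller a r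
smaller-∷ a c r = begin
  smaller a (suc c ∷ r)                       ≡⟨ sumTo-cong a (λ b _ → trans (count-∷ (suc b) (suc c) r) (cong (_+ rowCount r b) (⟦≐⟧-sym c b))) ⟩
  sumTo (λ b → ⟦ b ≐ c ⟧ + rowCount r b) a    ≡⟨ sumTo-+ (λ b → ⟦ b ≐ c ⟧) (rowCount r) a ⟩
  sumTo (λ b → ⟦ b ≐ c ⟧) a + smaller a r     ≡⟨ cong (_+ smaller a r) (sumTo-≐ c a) ⟩
  ⟦ c < a ⟧ + smaller a r ∎
  where open ≡-Reasoning

smaller-all : ∀ a {r} → All (Letter a) r → smaller a r ≡ length r
smaller-all a []                               = sumTo-0 a (λ _ _ → refl)
smaller-all a {suc c ∷ r} ((_ , c<a) ∷ ps) =
  trans (smaller-∷ a c r) (cong₂ _+_ (⟦<⟧-1 c<a) (smaller-all a ps))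

smaller-≤-length : ∀ a {r} → All (1 ≤_) r → smaller a r ≤ length r
smaller-≤-length a []                  = ≤-reflexive (sumTo-0 a (λ _ _ → refl))
smaller-≤-length a {suc b ∷ r} (_ ∷ ls) =
  ≤-trans (≤-reflexive (smaller-∷ a b r)) (+-mono-≤ (⟦<⟧-≤1 b a) (smaller-≤-length a ls))

smaller-≤ : ∀ a x r → smaller a r ≤ smaller a (x ∷ r)
smaller-≤ a x r = sumTo-mono a λ b _ → ≤-trans (m≤n+m _ ⟦ x ≐ suc b ⟧) (≤-reflexive (sym (count-∷ (suc b) x r)))

-- Row words run from right to left, so the head of `r` takes the largest column offset.
cells : (ℕ → Box) → List ℕ → List (Box × ℕ)
cells f r = zip (applyDownFrom f (length r)) r

module _ (f : ℕ → Box) where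

  -- The letters at most `a` are a suffix of a weakly decreasing word and fill the leftmost boxes of
  -- the row, with offsets below `smaller a r`. This lemma reads off the last of them, and
  -- `cell-large` a box to the right of them.
  cell-small : ∀ m a c {r} → AllPairs _≥_ r → All (Letter m) r → smaller a r ≡ suc c →
    ∃ λ x → x ≤ a × (f c , x) ∈ cells f r
  cell-small m a c [] [] eq = contradiction (trans (sym eq) (sumTo-0 a (λ _ _ → refl))) λ ()
  cell-small m a c {suc b ∷ r} (ge ∷ ps) ((_ , b≤m) ∷ ls) eq with ⟦<⟧-view b a
  ... | inj₁ (_ , b<a) = suc b , b<a , here (cong (λ z → f z , suc b) c≡)
    where
    c≡ : c ≡ length r
    c≡ = suc-injective (trans (sym eq) (smaller-all a ((s≤s z≤n , b<a) ∷
           All.zipWith (λ { (b≥x , (1≤x , _)) → 1≤x , ≤-trans b≥x b<a }) (ge , ls))))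
  ... | inj₂ (e , _) = let x , x≤a , x∈ = cell-small m a c ps ls
                             (trans (cong (_+ smaller a r) (sym e)) (trans (sym (smaller-∷ a b r)) eq))
                       in x , x≤a , there x∈

  cell-large : ∀ m a c {r} → AllPairs _≥_ r → All (Letter m) r → smaller a r ≤ c → c < length r →
    ∃ λ y → a < y × (f c , y) ∈ cells f r
  cell-large m a c {suc b ∷ r} (ge ∷ ps) ((_ , b≤m) ∷ ls) le c<l with m≤n⇒m<n∨m≡n (s≤s⁻¹ c<l)
  ... | inj₁ c<r = let y , a<y , y∈ = cell-large m a c ps ls (≤-trans (smaller-≤ a (suc b) r) le) c<r
                   in y , a<y , there y∈
  ... | inj₂ refl with ≤-<-connex (suc b) a
  ...   | inj₂ a≤b = suc b , a≤b , here refl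
  ...   | inj₁ b<a = contradiction (≤-trans (≤-reflexive (sym full)) le) (<⇒≱ ≤-refl)
    where
    full : smaller a (suc b ∷ r) ≡ suc (length r)
    full = smaller-all a ((s≤s z≤n , b<a) ∷
             All.zipWith (λ { (b≥x , (1≤x , _)) → 1≤x , ≤-trans b≥x b<a }) (ge , ls))


  cells-linked : ∀ r → (∀ c x y → (f c , x) ∈ cells f r → (f (suc c) , y) ∈ cells f r → x ≤ y) → Linked _≥_ r
  cells-linked []          h = []
  cells-linked (x ∷ [])    h = [-]
  cells-linked (x ∷ y ∷ r) h = h (length r) y x (there (here refl)) (here refl) ∷
    cells-linked (y ∷ r) (λ c x' y' x∈ y∈ → h c x' y' (there x∈) (there y∈))

-- The letters at least `a + 2` come first in a decreasing row. Cutting after them gives the prefix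
-- on which the lattice condition is tightest.
big-prefix : ∀ a {r} → AllPairs _≥_ r → ∃₂ λ u s → r ≡ u ++ s ×
  count (suc (suc a)) u ≡ count (suc (suc a)) r × count (suc a) u ≡ 0
big-prefix a []        = [] , [] , refl , refl , refl
big-prefix a {x ∷ r} (ge ∷ ps) with ≤-<-connex x (suc a)
... | inj₁ x≤ = [] , x ∷ r , refl ,
      sym (count-none (suc (suc a)) (<⇒≢ (s≤s x≤) ∷ All.map (λ x≥y → <⇒≢ (s≤s (≤-trans x≥y x≤))) ge)) , refl
... | inj₂ a<x with big-prefix a ps
... | u , s , eq , e₁ , e₂ = x ∷ u , s , cong (x ∷_) eq ,
      trans (count-∷ _ x u) (trans (cong (⟦ x ≐ suc (suc a) ⟧ +_) e₁) (sym (count-∷ _ x r))) ,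
      trans (count-∷ _ x u) (cong₂ _+_ x≐ e₂)
  where
  x≐ : ⟦ x ≐ suc a ⟧ ≡ 0
  x≐ with ≐-≡ᵇ x (suc a)
  ... | inj₁ (e , _) = contradiction (sym (≡ᵇ⇒≡ x (suc a) (from T-≡ e))) (<⇒≢ a<x)
  ... | inj₂ (_ , e) = e

-- From a tableau to its matrix.

module FromWord {n m : ℕ} {la mu : ℕ → ℕ} (la↓ : Decr la) (mu↓ : Decr mu) (mu≤la : ∀ i → mu i ≤ la i)
  {w : List ℕ} (len : length w ≡ length (boxes n la mu)) (letters : All (Letter m) w)
  (ss : SemiStd (zip (boxes n la mu) w))
  (lat : ∀ p s a → w ≡ p ++ s → a < m → count (suc (suc a)) p ≤ count (suc a) p) where

  rowLength : ℕ → ℕ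
  rowLength i = la i ∸ mu i

  len′ : length w ≡ sumTo rowLength n
  len′ = trans len (trans (length-catRows (rowBoxes la mu) n) (sumTo-cong n λ i _ → length-applyDownFrom _ (rowLength i)))

  r : ℕ → List ℕ
  r = chunk rowLength w

  w≡ : catRows r n ≡ w
  w≡ = catRows-chunk-all rowLength w n len′

  length-r : ∀ i → i < n → length (r i) ≡ rowLength i
  length-r = length-chunk rowLength w n len′

  F : ℕ → ℕ → Box
  F i c = suc i , suc (mu i + c)

  cell∈ : ∀ i → i < n → ∀ {x} → x ∈ cells (F i) (r i) → x ∈ zip (boxes n la mu) w
  cell∈ i i<n {x} x∈ = subst (λ z → x ∈ zip (boxes n la mu) z) w≡
    (subst (x ∈_) (sym (zip-catRows (rowBoxes la mu) r n
                     (λ i i<n → trans (length-applyDownFrom _ (rowLength i)) (sym (length-r i i<n)))))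
      (∈-catRows⁺ _ i n i<n (subst (λ l → x ∈ zip (applyDownFrom (F i) l) (r i)) (length-r i i<n) x∈)))

  letters-r : ∀ i → i < n → All (Letter m) (r i)
  letters-r i i<n = All.tabulate λ x∈ → All.lookup letters (subst (_ ∈_) w≡ (∈-catRows⁺ r i n i<n x∈))

  desc : ∀ i → i < n → AllPairs _≥_ (r i)
  desc i i<n = Linked⇒AllPairs (λ p q → ≤-trans q p) (cells-linked (F i) (r i) λ c x y x∈ y∈ →
    proj₁ (ss _ _ x _ _ y (cell∈ i i<n x∈) (cell∈ i i<n y∈)) refl (cong suc (+-suc (mu i) c)))

  t : ℕ → ℕ → ℕ
  t i = rowCount (r i)

  cnt-count : ∀ i a → cnt t i a ≡ count (suc a) (catRows r i)
  cnt-count i a = sym (length-filterᵇ-catRows _ r i)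

  -- If the bound failed, the last letter `x ≤ a + 1` of row `i + 1` would lie under a letter
  -- `y > a` of row `i`, while column strictness demands `y < x`.
  col : ∀ i a → suc i < n → pos mu t (suc i) (suc a) ≤ pos mu t i a
  col i a i<n with ≤-<-connex (pos mu t (suc i) (suc a)) (pos mu t i a)
  ... | inj₁ p = p
  ... | inj₂ gt = go (smaller (suc a) (r (suc i))) refl
    where
    go : ∀ q → smaller (suc a) (r (suc i)) ≡ q → pos mu t (suc i) (suc a) ≤ pos mu t i a
    go zero    eq = contradiction gt (≤⇒≯ (≤-trans
      (≤-reflexive (trans (cong (mu (suc i) +_) eq) (+-identityʳ _))) (≤-trans (mu↓ i) (m≤m+n (mu i) _))))
    go (suc c) eq =
      let x , x≤ , x∈ = cell-small (F (suc i)) m (suc a) c (desc (suc i) i<n) (letters-r (suc i) i<n) eq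
          y , a<y , y∈ = cell-large (F i) m a c' (desc i (<⇒≤ i<n)) (letters-r i (<⇒≤ i<n)) small≤ c'<
          y<x = proj₂ (ss _ _ y _ _ x (cell∈ i (<⇒≤ i<n) y∈) (cell∈ (suc i) i<n x∈)) refl (cong suc column)
      in contradiction (≤-trans (s≤s a<y) (≤-trans y<x x≤)) (<-irrefl refl)
      where
      -- The offset within row `i` of the column that contains `x`.
      c' = mu (suc i) + c ∸ mu i
      pos≡ : pos mu t (suc i) (suc a) ≡ suc (mu (suc i) + c)
      pos≡ = trans (cong (mu (suc i) +_) eq) (+-suc (mu (suc i)) c)
      above : mu i + smaller a (r i) ≤ mu (suc i) + c
      above = s≤s⁻¹ (≤-trans gt (≤-reflexive pos≡))
      mu≤ : mu i ≤ mu (suc i) + c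
      mu≤ = ≤-trans (m≤m+n _ _) above
      column : mu (suc i) + c ≡ mu i + c'
      column = sym (m+[n∸m]≡n mu≤)
      small≤ : smaller a (r i) ≤ c'
      small≤ = +-cancelˡ-≤ (mu i) _ _ (≤-trans above (≤-reflexive column))
      below : mu (suc i) + c < la (suc i)
      below = begin-strict
        mu (suc i) + c                       <⟨ ≤-reflexive (sym pos≡) ⟩
        mu (suc i) + smaller (suc a) (r (suc i)) ≤⟨ +-monoʳ-≤ (mu (suc i)) (smaller-≤-length (suc a) (All.map proj₁ (letters-r (suc i) i<n))) ⟩
        mu (suc i) + length (r (suc i))      ≡⟨ cong (mu (suc i) +_) (length-r (suc i) i<n) ⟩
        mu (suc i) + rowLength (suc i)       ≡⟨ m+[n∸m]≡n (mu≤la (suc i)) ⟩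
        la (suc i) ∎
        where open ≤-Reasoning
      c'< : c' < length (r i)
      c'< = subst (c' <_) (sym (length-r i (<⇒≤ i<n))) (∸-monoˡ-< (<-≤-trans below (la↓ i)) mu≤)

  lattice-r : ∀ i a → i < n → cnt t (suc i) (suc a) ≤ cnt t i a
  lattice-r i a i<n with ≤-<-connex m a
  -- The hypothesis `lat` covers only `a < m`; beyond that the letter `a + 2` does not occur.
  ... | inj₁ m≤a = ≤-trans (≤-reflexive (sumTo-0 (suc i) λ i' i'≤i → count-none (suc (suc a))
          (All.map (λ { (_ , x≤m) → <⇒≢ (s≤s (≤-trans x≤m (m≤n⇒m≤1+n m≤a))) }) (letters-r i' (≤-trans i'≤i i<n))))) z≤n
  ... | inj₂ a<m with big-prefix a (desc i i<n) | catRows-prefix r i<n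
  ... | u , s , eq , e₁ , e₂ | s' , eq' = begin
    cnt t (suc i) (suc a)                                   ≡⟨ cong (_+ t i (suc a)) (cnt-count i (suc a)) ⟩
    count (suc (suc a)) (catRows r i) + count (suc (suc a)) (r i) ≡⟨ cong (count (suc (suc a)) (catRows r i) +_) e₁ ⟨
    count (suc (suc a)) (catRows r i) + count (suc (suc a)) u ≡⟨ count-++ (suc (suc a)) (catRows r i) u ⟨
    count (suc (suc a)) (catRows r i ++ u)                  ≤⟨ lat (catRows r i ++ u) (s ++ s') a w-split a<m ⟩
    count (suc a) (catRows r i ++ u)                        ≡⟨ count-++ (suc a) (catRows r i) u ⟩
    count (suc a) (catRows r i) + count (suc a) u           ≡⟨ cong (count (suc a) (catRows r i) +_) e₂ ⟩
    count (suc a) (catRows r i) + 0                         ≡⟨ +-identityʳ _ ⟩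
    count (suc a) (catRows r i)                             ≡⟨ cnt-count i a ⟨
    cnt t i a ∎
    where
    open ≤-Reasoning
    w-split : w ≡ (catRows r i ++ u) ++ s ++ s'
    w-split = trans (sym w≡) (trans eq' (trans (cong (λ z → (catRows r i ++ z) ++ s') eq)
      (trans (cong (_++ s') (sym (++-assoc (catRows r i) u s))) (++-assoc (catRows r i ++ u) s s'))))

  matrix : LRMatrix n m la mu t
  matrix = record
    { row-full   = λ i i<n → trans (cong (mu i +_) (trans (smaller-all m (letters-r i i<n)) (length-r i i<n))) (m+[n∸m]≡n (mu≤la i))
    ; col-strict = col
    ; lattice    = lattice-r }

  cnt-w : ∀ a → cnt t n a ≡ count (suc a) w
  cnt-w a = trans (cnt-count n a) (cong (count (suc a)) w≡)

-- From a matrix to its tableau.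

rowWord : (ℕ → ℕ) → ℕ → List ℕ
rowWord τ zero    = []
rowWord τ (suc m) = replicate (τ m) (suc m) ++ rowWord τ m

length-rowWord : ∀ τ m → length (rowWord τ m) ≡ sumTo τ m
length-rowWord τ zero    = refl
length-rowWord τ (suc m) = trans (length-++ (replicate (τ m) (suc m)))
  (trans (cong₂ _+_ (length-replicate (τ m)) (length-rowWord τ m)) (+-comm (τ m) _))

rowWord-letters : ∀ τ {M} m → m ≤ M → All (Letter M) (rowWord τ m)
rowWord-letters τ zero    m≤M = []
rowWord-letters τ (suc m) m≤M =
  ++⁺ (replicate⁺ (τ m) (s≤s z≤n , m≤M)) (rowWord-letters τ m (<⇒≤ m≤M))

count-replicate : ∀ a k m → count (suc a) (replicate k (suc m)) ≡ k * ⟦ a ≐ m ⟧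
count-replicate a zero    m = refl
count-replicate a (suc k) m = trans (count-∷ (suc a) (suc m) (replicate k (suc m)))
  (cong₂ _+_ (⟦≐⟧-sym m a) (count-replicate a k m))

*-⟦≐⟧ : ∀ (τ : ℕ → ℕ) a m → τ m * ⟦ a ≐ m ⟧ ≡ τ a * ⟦ a ≐ m ⟧
*-⟦≐⟧ τ zero    zero    = refl
*-⟦≐⟧ τ zero    (suc m) = trans (*-zeroʳ (τ (suc m))) (sym (*-zeroʳ (τ 0)))
*-⟦≐⟧ τ (suc a) zero    = trans (*-zeroʳ (τ 0)) (sym (*-zeroʳ (τ (suc a))))
*-⟦≐⟧ τ (suc a) (suc m) = *-⟦≐⟧ (τ ∘ suc) a m

count-rowWord : ∀ τ a m → count (suc a) (rowWord τ m) ≡ τ a * ⟦ a < m ⟧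
count-rowWord τ a zero    = sym (*-zeroʳ (τ a))
count-rowWord τ a (suc m) = begin
  count (suc a) (replicate (τ m) (suc m) ++ rowWord τ m)
    ≡⟨ count-++ (suc a) (replicate (τ m) (suc m)) (rowWord τ m) ⟩
  count (suc a) (replicate (τ m) (suc m)) + count (suc a) (rowWord τ m)
    ≡⟨ cong₂ _+_ (trans (count-replicate a (τ m) m) (*-⟦≐⟧ τ a m)) (count-rowWord τ a m) ⟩
  τ a * ⟦ a ≐ m ⟧ + τ a * ⟦ a < m ⟧ ≡⟨ *-distribˡ-+ (τ a) _ _ ⟨
  τ a * (⟦ a ≐ m ⟧ + ⟦ a < m ⟧)     ≡⟨ cong (τ a *_) (trans (+-comm ⟦ a ≐ m ⟧ _) (sym (⟦<⟧-suc a m))) ⟩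
  τ a * ⟦ a < suc m ⟧ ∎
  where open ≡-Reasoning

applyDownFrom-+ : ∀ {A : Set} (f : ℕ → A) l k →
  applyDownFrom f (l + k) ≡ applyDownFrom (λ c → f (l + c)) k ++ applyDownFrom f l
applyDownFrom-+ f l zero    = cong (applyDownFrom f) (+-identityʳ l)
applyDownFrom-+ f l (suc k) = trans (cong (applyDownFrom f) (+-suc l k)) (cong (f (l + k) ∷_) (applyDownFrom-+ f l k))

∈-zip-replicate⁻ : ∀ {A : Set} (f : ℕ → A) (x : ℕ) k {y} →
  y ∈ zip (applyDownFrom f k) (replicate k x) → ∃ λ c → c < k × y ≡ (f c , x)
∈-zip-replicate⁻ f x (suc k) (here refl) = k , ≤-refl , refl
∈-zip-replicate⁻ f x (suc k) (there y∈) =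
  let c , c<k , eq = ∈-zip-replicate⁻ f x k y∈ in c , m<n⇒m<1+n c<k , eq

-- The block of the largest letter comes first in the word and takes the rightmost boxes. Splitting
-- it off leaves the same row shortened to `sumTo τ m` boxes.
∈-rowWord⁻ : ∀ i μ τ m {i' j x} →
  ((i' , j) , x) ∈ zip (applyDownFrom (λ c → suc i , suc (μ + c)) (sumTo τ m)) (rowWord τ m) →
  i' ≡ suc i × ∃ λ b → x ≡ suc b × μ + sumTo τ b < j × j ≤ μ + sumTo τ (suc b)
∈-rowWord⁻ i μ τ (suc m) y∈ with ∈-++⁻ (zip (applyDownFrom (λ c → f (l + c)) (τ m)) (replicate (τ m) (suc m))) (subst (_ ∈_) eq y∈)
  where
  f : ℕ → Box
  f c = suc i , suc (μ + c)
  l = sumTo τ m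
  eq : zip (applyDownFrom f (l + τ m)) (rowWord τ (suc m)) ≡
       zip (applyDownFrom (λ c → f (l + c)) (τ m)) (replicate (τ m) (suc m)) ++ zip (applyDownFrom f l) (rowWord τ m)
  eq = trans (cong (λ z → zip z (rowWord τ (suc m))) (applyDownFrom-+ f l (τ m)))
         (zip-++ (applyDownFrom (λ c → f (l + c)) (τ m)) (replicate (τ m) (suc m))
           (trans (length-applyDownFrom _ (τ m)) (sym (length-replicate (τ m)))))
... | inj₂ y∈ʳ = ∈-rowWord⁻ i μ τ m y∈ʳ
... | inj₁ y∈ˡ with ∈-zip-replicate⁻ (λ c → suc i , suc (μ + (sumTo τ m + c))) (suc m) (τ m) y∈ˡ
... | c , c< , refl = refl , m , refl , s≤s (+-monoʳ-≤ μ (m≤m+n _ c)) ,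
      ≤-trans (≤-reflexive (sym (+-suc μ _))) (+-monoʳ-≤ μ (≤-trans (≤-reflexive (sym (+-suc _ c))) (+-monoʳ-≤ (sumTo τ m) c<)))

++-split : ∀ {A : Set} (xs : List A) {ys} p {s} → xs ++ ys ≡ p ++ s →
  (∃ λ v → xs ≡ p ++ v) ⊎ (∃ λ u → p ≡ xs ++ u × ys ≡ u ++ s)
++-split xs       []      eq = inj₁ (xs , refl)
++-split []       (y ∷ p) eq = inj₂ (y ∷ p , refl , eq)
++-split (x ∷ xs) (y ∷ p) eq with ∷-injective eq
... | refl , eq' with ++-split xs p eq'
...   | inj₁ (v , e)      = inj₁ (v , cong (x ∷_) e)
...   | inj₂ (u , e , e') = inj₂ (u , cong (x ∷_) e , e')

catRows-split : ∀ {A : Set} (r : ℕ → List A) n p {s} → catRows r n ≡ p ++ s →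
  p ≡ [] ⊎ (∃ λ i → i < n × ∃₂ λ u v → p ≡ catRows r i ++ u × r i ≡ u ++ v)
catRows-split r zero    []      eq = inj₁ refl
catRows-split r (suc n) p {s} eq with ++-split (catRows r n) p eq
... | inj₂ (u , e , e') = inj₂ (n , ≤-refl , u , s , e , e')
... | inj₁ (v , e) with catRows-split r n p e
...   | inj₁ e' = inj₁ e'
...   | inj₂ (i , i<n , rest) = inj₂ (i , m<n⇒m<1+n i<n , rest)

module ToWord {n m : ℕ} {la mu : ℕ → ℕ} {t : ℕ → ℕ → ℕ} (M : LRMatrix n m la mu t)
  (t-0 : ∀ i → i < n → ∀ a → m ≤ a → t i a ≡ 0) where
  open LRMatrix M

  r : ℕ → List ℕ
  r i = rowWord (t i) m

  word : List ℕ
  word = catRows r n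

  rowLength : ∀ i → i < n → la i ∸ mu i ≡ sumTo (t i) m
  rowLength i i<n = trans (cong (_∸ mu i) (sym (row-full i i<n))) (m+n∸m≡n (mu i) _)

  length-rows : ∀ i → i < n → length (rowBoxes la mu i) ≡ length (r i)
  length-rows i i<n = trans (length-applyDownFrom _ (la i ∸ mu i)) (trans (rowLength i i<n) (sym (length-rowWord (t i) m)))

  length-word : length word ≡ length (boxes n la mu)
  length-word = trans (length-catRows r n) (trans (sumTo-cong n (λ i i<n → sym (length-rows i i<n))) (sym (length-catRows (rowBoxes la mu) n)))

  letters : All (Letter m) word
  letters = All.tabulate λ x∈ → let i , _ , x∈i = ∈-catRows⁻ r n x∈ in All.lookup (rowWord-letters (t i) m ≤-refl) x∈i

  count-row : ∀ i → i < n → ∀ a → count (suc a) (r i) ≡ t i a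
  count-row i i<n a with ⟦<⟧-view a m
  ... | inj₁ (e , _)   = trans (count-rowWord (t i) a m) (trans (cong (t i a *_) e) (*-identityʳ _))
  ... | inj₂ (e , m≤a) = trans (count-rowWord (t i) a m) (trans (cong (t i a *_) e) (trans (*-zeroʳ (t i a)) (sym (t-0 i i<n a m≤a))))

  count-rows : ∀ a i → i ≤ n → count (suc a) (catRows r i) ≡ cnt t i a
  count-rows a i i≤n = trans (length-filterᵇ-catRows _ r i) (sumTo-cong i λ i' i'<i → count-row i' (<-≤-trans i'<i i≤n) a)

  -- A nonempty prefix ends inside some row `i`. It has at most as many letters `a + 2` as the rows
  -- up to and including `i`, and at least as many letters `a + 1` as the rows above `i`; the matrix
  -- condition compares these two numbers.
  lattice-word : ∀ a p s → word ≡ p ++ s → count (suc (suc a)) p ≤ count (suc a) p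
  lattice-word a p s eq with catRows-split r n p eq
  ... | inj₁ refl = z≤n
  ... | inj₂ (i , i<n , u , v , refl , ri≡) = begin
    count (suc (suc a)) (catRows r i ++ u)      ≡⟨ count-++ (suc (suc a)) (catRows r i) u ⟩
    count (suc (suc a)) (catRows r i) + count (suc (suc a)) u
      ≤⟨ +-monoʳ-≤ (count (suc (suc a)) (catRows r i)) (m≤m+n _ (count (suc (suc a)) v)) ⟩
    count (suc (suc a)) (catRows r i) + (count (suc (suc a)) u + count (suc (suc a)) v)
      ≡⟨ cong (count (suc (suc a)) (catRows r i) +_) (trans (sym (count-++ (suc (suc a)) u v)) (cong (count (suc (suc a))) (sym ri≡))) ⟩
    count (suc (suc a)) (catRows r i) + count (suc (suc a)) (r i)
      ≡⟨ count-++ (suc (suc a)) (catRows r i) (r i) ⟨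
    count (suc (suc a)) (catRows r (suc i))     ≡⟨ count-rows (suc a) (suc i) i<n ⟩
    cnt t (suc i) (suc a)                       ≤⟨ lattice i a i<n ⟩
    cnt t i a                                   ≡⟨ count-rows a i (<⇒≤ i<n) ⟨
    count (suc a) (catRows r i)                 ≤⟨ m≤m+n _ _ ⟩
    count (suc a) (catRows r i) + count (suc a) u ≡⟨ count-++ (suc a) (catRows r i) u ⟨
    count (suc a) (catRows r i ++ u) ∎
    where open ≤-Reasoning

  cell⁻ : ∀ {i j x} → ((i , j) , x) ∈ zip (boxes n la mu) word →
    ∃ λ i' → i ≡ suc i' × i' < n × ∃ λ b → x ≡ suc b × pos mu t i' b < j × j ≤ pos mu t i' (suc b)
  cell⁻ x∈ with ∈-catRows⁻ _ n (subst (_ ∈_) (zip-catRows (rowBoxes la mu) r n length-rows) x∈)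
  ... | i' , i'<n , x∈' with ∈-rowWord⁻ i' (mu i') (t i') m
                               (subst (λ l → _ ∈ zip (applyDownFrom (λ c → suc i' , suc (mu i' + c)) l) (r i')) (rowLength i' i'<n) x∈')
  ... | e , rest = i' , e , i'<n , rest

  pos-cancel-< : ∀ i {a b} → pos mu t i a < pos mu t i b → a < b
  pos-cancel-< i {a} {b} lt with ≤-<-connex b a
  ... | inj₂ a<b = a<b
  ... | inj₁ b≤a = contradiction lt (≤⇒≯ (+-monoʳ-≤ (mu i) (sumTo-monoʳ (t i) b≤a)))

  -- As `pos` is monotone in the letter, two letters are compared by enclosing a column between two
  -- values of `pos` in one row; for boxes in the same column, `col-strict` first carries the lower
  -- row's bound up to the row above.
  semiStd : SemiStd (zip (boxes n la mu) word)
  semiStd i j x i' j' y x∈ y∈ with cell⁻ x∈ | cell⁻ y∈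
  ... | k , refl , k<n , b , refl , lo , hi | k' , refl , k'<n , b' , refl , lo' , hi' = row , col
    where
    row : suc k' ≡ suc k → j' ≡ suc j → suc b ≤ suc b'
    row refl refl = pos-cancel-< k (<-trans lo hi')
    col : suc k' ≡ suc (suc k) → j' ≡ j → suc b < suc b'
    col refl refl = s≤s (pos-cancel-< k (<-≤-trans lo (≤-trans hi' (col-strict k b' k'<n))))

  count-word : ∀ a → count (suc a) word ≡ cnt t n a
  count-word a = count-rows a n ≤-refl

-- Contents of matrices as partitions.

support : ∀ (f : ℕ → ℕ) → Decr f → ∀ n → (∀ a → n ≤ a → f a ≡ 0) →
  ∃ λ m → m ≤ n × (∀ a → a < m → 1 ≤ f a) × (∀ a → m ≤ a → f a ≡ 0)
support f f↓ zero    f0 = 0 , z≤n , (λ _ ()) , f0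
support f f↓ (suc n) f0 with f n in eq
... | suc _ = suc n , ≤-refl , (λ a a≤n → ≤-trans (≤-trans (s≤s z≤n) (≤-reflexive (sym eq))) (Decr-mono f↓ (s≤s⁻¹ a≤n))) , f0
... | zero  = let m , m≤n , pos , z = support f f↓ n (λ a n≤a → n≤0⇒n≡0 (≤-trans (Decr-mono f↓ n≤a) (≤-reflexive eq)))
              in m , m≤n⇒m≤1+n m≤n , pos , z

IsPartition-applyUpTo : ∀ f → Decr f → ∀ m → (∀ a → a < m → 1 ≤ f a) → IsPartition (applyUpTo f m)
IsPartition-applyUpTo f f↓ zero          f>0 = _
IsPartition-applyUpTo f f↓ (suc zero)    f>0 = f>0 0 ≤-refl
IsPartition-applyUpTo f f↓ (suc (suc m)) f>0 =
  f↓ 0 , IsPartition-applyUpTo (f ∘ suc) (f↓ ∘ suc) (suc m) (λ a a<m → f>0 (suc a) (s≤s a<m))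

part-applyUpTo : ∀ f m → (∀ a → m ≤ a → f a ≡ 0) → ∀ a → part (applyUpTo f m) a ≡ f a
part-applyUpTo f zero    f0 a       = sym (f0 a z≤n)
part-applyUpTo f (suc m) f0 zero    = refl
part-applyUpTo f (suc m) f0 (suc a) = part-applyUpTo (f ∘ suc) m (λ a m≤a → f0 (suc a) (s≤s m≤a)) a

outerHook-cong : ∀ m {f g : ℕ → ℕ} → (∀ a → f a ≡ g a) → ∀ k → outerHook m f k ≡ outerHook m g k
outerHook-cong m eq k = sumTo-cong (m ∸ k) λ a _ → cong (_∸ k) (eq (k + a))

outerHook-stop : ∀ {m n} (f : ℕ → ℕ) → m ≤ n → (∀ a → m ≤ a → f a ≡ 0) → ∀ k → outerHook n f k ≡ outerHook m f k
outerHook-stop {m} f m≤n f0 k = sumTo-stop (λ a → f (k + a) ∸ k) (∸-monoˡ-≤ k m≤n) λ a le →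
  trans (cong (_∸ k) (f0 (k + a) (≤-trans (m≤n+m∸n m k) (+-monoʳ-≤ k le)))) (0∸n≡0 k)

-- Attainment and maximality of the ribbon sequence.

module _ (la mu : List ℕ) (pla : IsPartition la) (pmu : IsPartition mu) (mu⊆la : mu ⊆ₚ la) where

  private
    n = length la
    λ' = part la
    μ' = part mu
    λ↓ : Decr λ'
    λ↓ = part↓ la pla
    μ↓ : Decr μ'
    μ↓ = part↓ mu pmu
    μ≤λ : ∀ i → μ' i ≤ λ' i
    μ≤λ i = mu⊆la (suc i)

  appears⇒matrix : ∀ ν → Appears la mu ν →
    ∃ λ t → LRMatrix n (length ν) λ' μ' t × (∀ a → cnt t n a ≡ part ν a)
  appears⇒matrix ν (pν , c≢0) with LRcoeff⁻ la mu ν c≢0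
  ... | w , w∈ , h rewrite skewBoxes-boxes la mu
    with words⁻ (length ν) (length (boxes n λ' μ')) w∈ | to (T-∧ {semistandardB (zip (boxes n λ' μ') w)}) h
  ... | len , letters | hs , hcl with to (T-∧ {contentB ν w}) hcl
  ... | hc , hl = t , matrix , content
    where
    lat : ∀ p s a → w ≡ p ++ s → a < length ν → count (suc (suc a)) p ≤ count (suc a) p
    lat p s a refl a<m = ≤ᵇ⇒≤ _ _ (allB⁻ _ (allB⁻ (inits w) hl p (inits⁺ p s)) (suc a) (∈-applyUpTo⁺ suc a<m))
    open FromWord {n} λ↓ μ↓ μ≤λ len letters (semistandardB⁻ (zip (boxes n λ' μ') w) hs) lat
    content : ∀ a → cnt t n a ≡ part ν a
    content a with ≤-<-connex (length ν) a
    ... | inj₂ a<m = trans (cnt-w a) (≡ᵇ⇒≡ _ _ (allB⁻ _ hc (suc a) (∈-applyUpTo⁺ suc a<m)))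
    ... | inj₁ m≤a = trans (cnt-w a) (trans
          (count-none (suc a) (All.map (λ { (_ , x≤m) → <⇒≢ (s≤s (≤-trans x≤m m≤a)) }) letters)) (sym (part-0 ν a m≤a)))

  matrix⇒appears : ∀ {t} → LRMatrix n n λ' μ' t →
    ∃ λ ν → Appears la mu ν × (∀ k → outerHook (length ν) (part ν) k ≡ outerHook n (cnt t n) k)
  -- `IsPartition` demands positive parts, so the trailing zeros of the content are cut off.
  matrix⇒appears {t} M with support (cnt t n) (cnt↓ M n ≤-refl) n (λ a n≤a → cnt-0 M n a ≤-refl n≤a)
  ... | m , m≤n , f>0 , f0 = ν , (pν , LRcoeff⁺ la mu ν word word∈ isLR) , outer
    where
    f = cnt t n
    ν = applyUpTo f m
    pν = IsPartition-applyUpTo f (cnt↓ M n ≤-refl) m f>0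
    t-0 : ∀ i → i < n → ∀ a → m ≤ a → t i a ≡ 0
    t-0 i i<n a m≤a = n≤0⇒n≡0 (≤-trans (m≤n+m (t i a) (cnt t i a))
      (≤-trans (sumTo-monoʳ (λ i' → t i' a) i<n) (≤-reflexive (f0 a m≤a))))
    -- The same matrix with the letter bound lowered to the length of `ν`, the bound used by
    -- `LRcoeff`.
    M′ : LRMatrix n m λ' μ' t
    M′ = record
      { row-full   = λ i i<n → trans (cong (μ' i +_) (sym (sumTo-stop (t i) m≤n (t-0 i i<n)))) (LRMatrix.row-full M i i<n)
      ; col-strict = LRMatrix.col-strict M
      ; lattice    = LRMatrix.lattice M }
    open ToWord M′ t-0
    len-ν : length ν ≡ m
    len-ν = length-applyUpTo f m
    word∈ : word ∈ words (length ν) (length (skewBoxes la mu))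
    word∈ = subst₂ (λ k l → word ∈ words k l) (sym len-ν)
      (trans length-word (cong length (sym (skewBoxes-boxes la mu)))) (words⁺ m letters)
    content : T (contentB ν word)
    content = allB⁺ (applyUpTo suc (length ν)) λ a a∈ → ok a (∈-applyUpTo⁻ suc a∈)
      where
      ok : ∀ a → (∃ λ b → b < length ν × a ≡ suc b) → T (count a word ≡ᵇ rowLen ν a)
      ok _ (b , _ , refl) = ≡⇒≡ᵇ _ _ (trans (count-word b) (sym (part-applyUpTo f m f0 b)))
    latticeOK : T (latticeB (length ν) word)
    latticeOK = allB⁺ (inits word) λ p p∈ → allB⁺ (applyUpTo suc (length ν)) λ a a∈ →
      ok p (inits⁻ word p∈) a (∈-applyUpTo⁻ suc a∈)
      where
      ok : ∀ p → (∃ λ s → word ≡ p ++ s) → ∀ a → (∃ λ b → b < length ν × a ≡ suc b) → T (count (suc a) p ≤ᵇ count a p)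
      ok p (s , eq) _ (b , _ , refl) = ≤⇒≤ᵇ (lattice-word b p s eq)
    isLR : T (isLRB (skewBoxes la mu) ν word)
    isLR = from (T-∧ {semistandardB (zip (skewBoxes la mu) word)})
      ( subst (λ bs → T (semistandardB (zip bs word))) (sym (skewBoxes-boxes la mu)) (semistandardB⁺ _ semiStd)
      , from (T-∧ {contentB ν word}) (content , latticeOK))
    outer : ∀ k → outerHook (length ν) (part ν) k ≡ outerHook n f k
    outer k = trans (cong (λ l → outerHook l (part ν) k) len-ν)
      (trans (outerHook-cong m (part-applyUpTo f m f0) k) (sym (outerHook-stop f m≤n f0 k)))

  πnw-inner : ∀ k → πnw (skewBoxes la mu) k + inner n λ' μ' (suc k) ≡ inner n λ' μ' k
  πnw-inner k = subst (λ A → πnw A k + inner n λ' μ' (suc k) ≡ inner n λ' μ' k) (sym (skewBoxes-boxes la mu))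
    (trans (cong (πnw (boxes n λ' μ') k +_) (sym (length-iterNw {n} λ↓ μ↓ (suc k))))
      (trans (πnw-iterNw (boxes n λ' μ') k) (length-iterNw {n} λ↓ μ↓ k)))

  attained : Σ (List ℕ) λ ν → Appears la mu ν × (∀ k → hl ν k ≡ πnw (skewBoxes la mu) k)
  attained =
    let t , M , ext     = ∃-extremal n λ' μ' λ↓ μ↓ μ≤λ
        ν , app , outer = matrix⇒appears M
    in ν , app , hl≡ ν (proj₁ app) (λ k → trans (outer k) (ext k))
    where
    hl≡ : ∀ ν → IsPartition ν → (∀ k → outerHook (length ν) (part ν) k ≡ inner n λ' μ' k) →
      ∀ k → hl ν k ≡ πnw (skewBoxes la mu) k
    hl≡ ν pν tail≡ k = +-cancelʳ-≡ (inner n λ' μ' (suc k)) (hl ν k) (πnw (skewBoxes la mu) k)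
      (trans (cong (hl ν k +_) (sym (tail≡ (suc k))))
        (trans (hl-outerHook ν pν k) (trans (tail≡ k) (sym (πnw-inner k)))))

  maximal : ∀ ν → Appears la mu ν → LexLeq (hl ν) (πnw (skewBoxes la mu))
  maximal ν app =
    let t , M , content = appears⇒matrix ν app
        outer≡ = outerHook-cong (length ν) content
    in LexLeq-tails (length ν) (hl ν) (πnw (skewBoxes la mu)) (outerHook (length ν) (part ν)) (inner n λ' μ')
      (hl-outerHook ν (proj₁ app)) πnw-inner
      (λ k → ≤-trans (UpperBound.inner≤outer M k) (≤-reflexive (outer≡ k)))
      (trans (sym (outer≡ 0)) (UpperBound.outer≡inner₀ M))
      (λ k m≤k → cong (sumTo (λ a → part ν (k + a) ∸ k)) (m≤n⇒m∸n≡0 m≤k))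

theorem4p5 : (la mu : List ℕ) → IsPartition la → IsPartition mu → mu ⊆ₚ la →
    IsHL la mu (πnw (skewBoxes la mu))
theorem4p5 la mu pla pmu mu⊆la = attained la mu pla pmu mu⊆la , maximal la mu pla pmu mu⊆la
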